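{- Let $q$ be a prime power, $e\in\{0,1,2\}$, and $r$ an integer with $r$ odd if $e\in\{0,2\}$ and $r$ even if $e=1$. If there exists a hyperbolic ($e=0$), parabolic ($e=1$) or elliptic ($e=2$) affine vector space partition of ${\rm PG}(r+1,q)$, then the non-degenerate quadric $\mathcal Q_{r+2,e}$ of ${\rm PG}(r+2,q)$ (i.e. $\mathcal Q^+(r+2,q)$, $\mathcal Q(r+2,q)$, $\mathcal Q^-(r+2,q)$ respectively) admits a spread.
   Context: Notation: $\mathcal Q_{m,e}$ denotes a non-degenerate quadric of ${\rm PG}(m,q)$ which is hyperbolic $\mathcal Q^+(m,q)$ if $e=0$ ($m$ odd), parabolic $\mathcal Q(m,q)$ if $e=1$ ($m$ even), elliptic $\mathcal Q^-(m,q)$ if $e=2$ ($m$ odd). A generator of $\mathcal Q_{m,e}$ is a projective subspace of maximal dimension contained in it; generators are $\frac{m-e-1}{2}$-dimensional. A spread of $\mathcal Q_{m,e}$ is a set of $q^{\frac{m+e-1}{2}}+1$ pairwise disjoint generators (equivalently, a set of generators partitioning the points of the quadric). An $s$-space means an $s$-dimensional projective subspace. Affine vector space partition (avsp): given a hyperplane $H$ of ${\rm PG}(r+1,q)$, an avsp of ${\rm PG}(r+1,q)$ (with respect to $H$) is a set $\mathcal P$ of subspaces of ${\rm PG}(r+1,q)$, none contained in $H$, such that every point of ${\rm PG}(r+1,q)\setminus H$ lies in exactly one member of $\mathcal P$. Hyperbolic/parabolic/elliptic avsp: with $e=0,1,2$ respectively, an avsp $\mathcal P=\{S_1,\dots,S_N\}$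 of ${\rm PG}(r+1,q)$ with respect to a hyperplane $H$, where $N=q^{\frac{r+e+1}{2}}$ and every $S_i$ is a $\frac{r-e+1}{2}$-space, is called hyperbolic, parabolic or elliptic if the sets $\Pi_i=S_i\cap H$ ($i=1,\dots,N$) are $N$ generators of a non-degenerate quadric $\mathcal Q_{r,e}\subset H$ such that: (1) each $\Pi_i$ is disjoint from a fixed generator $\Pi$ of $\mathcal Q_{r,e}$; (2) distinct $S_i,S_j$ meet in at most one point, and distinct $\Pi_i,\Pi_j$ meet in at most one point; (3) if $|\Pi_i\cap\Pi_j|=1$, then $\langle S_i,S_j\rangle\cap\mathcal Q_{r,e}$ is a non-degenerate hyperbolic quadric $\mathcal Q^+(r-e,q)$. -}

module Defs where

open import Algebra.Apartness.Bundles using (HeytingField; HeytingCommutativeRing)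
open import Algebra.Bundles using (CommutativeRing)
import Algebra.Properties.CommutativeMonoid.Sum as Sum
open import Data.Fin.Base using (Fin)
open import Data.Nat.Base as ℕ using (ℕ; suc; _≤_; _∸_; _^_; parity)
open import Data.Nat.DivMod using (_/_)
open import Data.Nat.Primality using (Prime)
open import Data.Parity.Base using (0ℙ; 1ℙ)
open import Data.Product.Base using (∃; ∃-syntax; ∃₂; Σ-syntax; _×_; _,_)
open import Data.Product using (∃!)
open import Data.Unit.Polymorphic using (⊤)
import Data.Vec.Functional as Vector
import Data.Vec.Functional.Relation.Binary.Equality.Setoid as VectorEquality
open import Function.Bundles using (Inverse)
open import Level using (Level; _⊔_) renaming (suc to lsuc)
open import Relation.Binary.PropositionalEquality using (_≡_; _≢_)
import Relation.Binary.PropositionalEquality as ≡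
open import Relation.Nullary.Negation using (¬_)
open import Relation.Unary using (Pred)

IsPrimePower : ℕ → Set
IsPrimePower q = ∃₂ λ p h → Prime p × 1 ≤ h × q ≡ p ^ h

record FiniteField (c ℓ₁ ℓ₂ : Level) (q : ℕ) : Set (lsuc (c ⊔ ℓ₁ ⊔ ℓ₂)) where
  field
    heytingField : HeytingField c ℓ₁ ℓ₂

  open HeytingField heytingField public using (heytingCommutativeRing)
  open HeytingCommutativeRing heytingCommutativeRing public using (commutativeRing)
  open CommutativeRing commutativeRing public using (setoid)

  field
    enumeration : Inverse (≡.setoid (Fin q)) setoid

data QuadricType : Set where
  hyperbolic parabolic elliptic : QuadricType

-- The parameter e.
index : QuadricType → ℕ
index hyperbolic = 0
index parabolic  = 1
index elliptic   = 2

-- The parity condition on m under which 𝒬_{m,e} makes sense. It makes m + e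
-- odd and forces m ≥ e - 1; hence every expression of the form
-- (… ∸ …) / 2 below is exact, without truncation.
Admissible : QuadricType → ℕ → Set
Admissible hyperbolic m = parity m ≡ 1ℙ
Admissible parabolic  m = parity m ≡ 0ℙ
Admissible elliptic   m = parity m ≡ 1ℙ

module Geometry {c ℓ₁ ℓ₂ : Level} {q : ℕ} (F : FiniteField c ℓ₁ ℓ₂ q) where

  open FiniteField F using (commutativeRing)
  open CommutativeRing commutativeRing
  open Sum +-commutativeMonoid using (sum-syntax)
  open VectorEquality setoid using (_≋_)

  -- Homogeneous coordinates for PG(m,q). The points of PG(m,q) are the
  -- vectors x with ¬ x ≋ 0ᵛ, up to _∼_.
  Vec : ℕ → Set c
  Vec m = Vector.Vector Carrier (suc m)

  0ᵛ : ∀ {m} → Vec m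
  0ᵛ = Vector.replicate _ 0#

  infixl 6 _+ᵛ_
  _+ᵛ_ : ∀ {m} → Vec m → Vec m → Vec m
  _+ᵛ_ = Vector.zipWith _+_

  infixr 7 _*ᵛ_
  _*ᵛ_ : ∀ {m} → Carrier → Vec m → Vec m
  a *ᵛ x = Vector.map (a *_) x

  infix 4 _∼_
  _∼_ : ∀ {m} → Vec m → Vec m → Set (c ⊔ ℓ₁)
  x ∼ y = ∃[ a ] ¬ a ≈ 0# × x ≋ a *ᵛ y

  -- A projective subspace of PG(m,q), as the underlying linear subspace; the
  -- zero subspace is the empty projective subspace.
  record Subspace (m : ℕ) : Set (lsuc (c ⊔ ℓ₁)) where
    field
      member   : Pred (Vec m) (c ⊔ ℓ₁)
      respects : ∀ {x y} → x ≋ y → member x → member y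
      0-closed : member 0ᵛ
      +-closed : ∀ {x y} → member x → member y → member (x +ᵛ y)
      *-closed : ∀ a {x} → member x → member (a *ᵛ x)

  open Subspace

  infix 4 _∈_ _∉_ _⊆_
  _∈_ : ∀ {m} → Vec m → Subspace m → Set (c ⊔ ℓ₁)
  x ∈ S = member S x

  _∉_ : ∀ {m} → Vec m → Subspace m → Set (c ⊔ ℓ₁)
  x ∉ S = ¬ x ∈ S

  _⊆_ : ∀ {m} → Subspace m → Subspace m → Set (c ⊔ ℓ₁)
  S ⊆ T = ∀ {x} → x ∈ S → x ∈ T

  whole : ∀ {m} → Subspace m
  whole = record
    { member   = λ _ → ⊤
    ; respects = λ _ _ → _
    ; 0-closed = _
    ; +-closed = λ _ _ → _
    ; *-closed = λ _ _ → _
    }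

  infixr 7 _∩_
  _∩_ : ∀ {m} → Subspace m → Subspace m → Subspace m
  S ∩ T = record
    { member   = λ x → x ∈ S × x ∈ T
    ; respects = λ x≋y (x∈S , x∈T) → respects S x≋y x∈S , respects T x≋y x∈T
    ; 0-closed = 0-closed S , 0-closed T
    ; +-closed = λ (x∈S , x∈T) (y∈S , y∈T) → +-closed S x∈S y∈S , +-closed T x∈T y∈T
    ; *-closed = λ a (x∈S , x∈T) → *-closed S a x∈S , *-closed T a x∈T
    }

  ⟨_,_⟩ : ∀ {m} → Subspace m → Subspace m → Subspace m
  ⟨ S , T ⟩ = record
    { member   = λ x → ∃₂ λ u v → u ∈ S × v ∈ T × x ≋ u +ᵛ v
    ; respects = λ x≋y (u , v , u∈S , v∈T , x≋u+v) →
        u , v , u∈S , v∈T , λ i → trans (sym (x≋y i)) (x≋u+v i)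
    ; 0-closed = 0ᵛ , 0ᵛ , 0-closed S , 0-closed T , λ _ → sym (+-identityˡ 0#)
    ; +-closed = λ (u , v , u∈S , v∈T , x≋u+v) (u′ , v′ , u′∈S , v′∈T , y≋u′+v′) →
        u +ᵛ u′ , v +ᵛ v′ , +-closed S u∈S u′∈S , +-closed T v∈T v′∈T ,
        λ i → trans (+-cong (x≋u+v i) (y≋u′+v′ i)) (interchange (u i) (v i) (u′ i) (v′ i))
    ; *-closed = λ a (u , v , u∈S , v∈T , x≋u+v) →
        a *ᵛ u , a *ᵛ v , *-closed S a u∈S , *-closed T a v∈T ,
        λ i → trans (*-congˡ (x≋u+v i)) (distribˡ a (u i) (v i))
    }
    where
    open import Algebra.Properties.CommutativeSemigroup +-commutativeSemigroup using (interchange)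

  combination : ∀ {m k} → (Fin k → Carrier) → (Fin k → Vec m) → Vec m
  combination {k = k} a b j = ∑[ i < k ] (a i * b i j)

  record IsBasis {m k : ℕ} (S : Subspace m) (b : Fin k → Vec m) : Set (c ⊔ ℓ₁) where
    field
      members     : ∀ i → b i ∈ S
      independent : ∀ a → combination a b ≋ 0ᵛ → ∀ i → a i ≈ 0#
      spanning    : ∀ {x} → x ∈ S → ∃[ a ] x ≋ combination a b

  -- Linear dimension, i.e. projective dimension plus one, so that the empty
  -- subspace (projective dimension -1) is covered.
  HasRank : ∀ {m} → Subspace m → ℕ → Set (c ⊔ ℓ₁)
  HasRank {m} S k = Σ[ b ∈ (Fin k → Vec m) ] IsBasis S b

  _IsSpaceOfDim_ : ∀ {m} → Subspace m → ℕ → Set (c ⊔ ℓ₁)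
  S IsSpaceOfDim s = HasRank S (suc s)

  Disjoint : ∀ {m} → Subspace m → Subspace m → Set (c ⊔ ℓ₁)
  Disjoint S T = ∀ {x} → x ∈ S → x ∈ T → x ≋ 0ᵛ

  AtMostOnePoint : ∀ {m} → Subspace m → Set (c ⊔ ℓ₁)
  AtMostOnePoint S = ∀ {x y} → x ∈ S → y ∈ S → ¬ x ≋ 0ᵛ → ¬ y ≋ 0ᵛ → x ∼ y

  ExactlyOnePoint : ∀ {m} → Subspace m → Set (c ⊔ ℓ₁)
  ExactlyOnePoint S = (∃[ x ] x ∈ S × ¬ x ≋ 0ᵛ) × AtMostOnePoint S

  -- The form ∑ᵢⱼ fᵢⱼ xᵢ xⱼ. The matrix f is neither required to be symmetric
  -- (which would lose forms in characteristic 2) nor triangular, so a form may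
  -- be represented by several matrices.
  QuadraticForm : ℕ → Set c
  QuadraticForm m = Fin (suc m) → Fin (suc m) → Carrier

  infix 8 _⟦_⟧
  _⟦_⟧ : ∀ {m} → QuadraticForm m → Vec m → Carrier
  _⟦_⟧ {m} f x = ∑[ i < suc m ] ∑[ j < suc m ] (f i j * (x i * x j))

  polar : ∀ {m} → QuadraticForm m → Vec m → Vec m → Carrier
  polar f x y = f ⟦ x +ᵛ y ⟧ - f ⟦ x ⟧ - f ⟦ y ⟧

  -- A quadric of a subspace U is the set of points of U on which a quadratic
  -- form vanishes. The form is given on the ambient space (every quadratic form
  -- on U extends to it), and only its restriction to U matters.

  -- Non-degenerate in the sense of quadrics: no singular vector in the radical
  -- of the polar form. In characteristic 2 the polar form itself may be
  -- degenerate.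
  NonDegenerate : ∀ {m} → QuadraticForm m → Subspace m → Set (c ⊔ ℓ₁)
  NonDegenerate f U =
    ∀ {x} → x ∈ U → f ⟦ x ⟧ ≈ 0# → (∀ {y} → y ∈ U → polar f x y ≈ 0#) → x ≋ 0ᵛ

  ContainedInQuadric : ∀ {m} → QuadraticForm m → Subspace m → Subspace m → Set (c ⊔ ℓ₁)
  ContainedInQuadric f U W = W ⊆ U × (∀ {x} → x ∈ W → f ⟦ x ⟧ ≈ 0#)

  record IsGenerator {m} (f : QuadraticForm m) (U W : Subspace m) : Set (lsuc (c ⊔ ℓ₁)) where
    field
      contained : ContainedInQuadric f U W
      rank      : ℕ
      hasRank   : HasRank W rank
      maximal   : ∀ W′ k → ContainedInQuadric f U W′ → HasRank W′ k → k ≤ rank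

  -- f defines on the m-space U a non-degenerate quadric 𝒬_{m,e}. For m of the
  -- right parity the type of a non-degenerate quadric is determined by the
  -- projective dimension (m - e - 1)/2 of its generators.
  record IsQuadric (t : QuadricType) {n} (f : QuadraticForm n) (U : Subspace n) (m : ℕ) :
                   Set (lsuc (c ⊔ ℓ₁)) where
    field
      admissible    : Admissible t m
      dimension     : U IsSpaceOfDim m
      nonDegenerate : NonDegenerate f U
      generator     : Subspace n
      isGenerator   : IsGenerator f U generator
      generatorRank : HasRank generator ((suc m ∸ index t) / 2)

  -- For m ≥ 1 + e (as for the quadrics 𝒬_{r+2,e}) generators are non-empty, so
  -- pairwise disjoint members are distinct and their number is as indicated.
  record Spread (t : QuadricType) {m} (f : QuadraticForm m) : Set (lsuc (c ⊔ ℓ₁)) where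
    field
      members    : Fin (q ^ ((m ℕ.+ index t ∸ 1) / 2) ℕ.+ 1) → Subspace m
      generators : ∀ i → IsGenerator f whole (members i)
      disjoint   : ∀ {i j} → i ≢ j → Disjoint (members i) (members j)

  -- The members of the family are automatically distinct: each has a point off
  -- H, and that point lies in only one of them.
  record IsAVSP {r N} (H : Subspace (suc r)) (S : Fin N → Subspace (suc r)) :
                Set (c ⊔ ℓ₁) where
    field
      hyperplane : H IsSpaceOfDim r
      notInH     : ∀ i → ¬ S i ⊆ H
      partition  : ∀ x → x ∉ H → ∃! _≡_ λ i → x ∈ S i

  -- A hyperbolic, parabolic or elliptic avsp of PG(r+1,q). The subspaces Πᵢ are
  -- indexed by the members of the partition and may coincide (as they must when
  -- r = 3 and e = 2, where there are more members than generators).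
  record QuadricAVSP (t : QuadricType) (r : ℕ) : Set (lsuc (c ⊔ ℓ₁)) where
    field
      H          : Subspace (suc r)
      S          : Fin (q ^ ((r ℕ.+ index t ℕ.+ 1) / 2)) → Subspace (suc r)
      isAVSP     : IsAVSP H S
      dimensions : ∀ i → S i IsSpaceOfDim ((suc r ∸ index t) / 2)
      form       : QuadraticForm (suc r)
      isQuadric  : IsQuadric t form H r

    Π : Fin (q ^ ((r ℕ.+ index t ℕ.+ 1) / 2)) → Subspace (suc r)
    Π i = S i ∩ H

    field
      Π-generators  : ∀ i → IsGenerator form H (Π i)
      Π₀            : Subspace (suc r)
      Π₀-generator  : IsGenerator form H Π₀
      Π₀-disjoint   : ∀ i → Disjoint (Π i) Π₀
      S-meet        : ∀ {i j} → i ≢ j → AtMostOnePoint (S i ∩ S j)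
      Π-meet        : ∀ {i j} → i ≢ j → AtMostOnePoint (Π i ∩ Π j)
      -- The quadric lies in H, so ⟨ S i , S j ⟩ meets it in ⟨ S i , S j ⟩ ∩ H.
      -- When r < e the Πᵢ are empty, so r ∸ e is only used when exact.
      hyperbolicity : ∀ {i j} → i ≢ j → ExactlyOnePoint (Π i ∩ Π j) →
                      IsQuadric hyperbolic form (⟨ S i , S j ⟩ ∩ H) (r ∸ index t)

{-# OPTIONS --safe #-}
module Submission where

-- Let b = 0 be an equation of H and put Q(a , x) = a b(x) + form(x), a form on
-- F × F^(r+2) with singular point P = (1 , 0) and P^⊥ / P = H. With s ∈ Sᵢ such
-- that b(s) = 1, the subspace Sᵢ lifts to the totally singular graph of
-- α(x) = b(x) form(s) - B(x , s), and Π₀ lifts to ⟨ P , Π₀ ⟩. A common point of two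
-- graphs lies over some x ∈ Πᵢ ∩ Πⱼ with B(x , sᵢ) = B(x , sⱼ), which puts x in the
-- radical of ⟨ Sᵢ , Sⱼ ⟩ ∩ H; so the lifts form a spread of Q. It is carried to f
-- because over a finite field non-degenerate forms of equal rank and Witt index
-- are similar: split off hyperbolic planes, and compare the anisotropic parts by
-- a pigeonhole argument.

open import Algebra.Apartness.Bundles using (HeytingField)
open import Algebra.Bundles using (CommutativeRing)
import Algebra.Properties.CommutativeMonoid.Sum
import Algebra.Properties.Ring
import Algebra.Properties.Semiring.Mult
import Algebra.Solver.Ring
open import Algebra.Solver.Ring.AlmostCommutativeRing using (fromCommutativeRing; _-Raw-AlmostCommutative⟶_)
open import Data.Empty using (⊥-elim)
open import Data.Fin.Base as Fin using (Fin; zero; suc; punchOut)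
import Data.Fin.Properties as Fin
open import Data.Integer.Base as ℤ using (ℤ; +_; -[1+_]; _⊖_)
import Data.Integer.Properties as ℤ
import Data.Maybe.Base as Maybe
open import Data.Nat using (ℕ; suc)
open import Data.Nat.Base as ℕ using (zero; z≤n; s≤s; _∸_; _≤_)
open import Data.Nat.DivMod using (_/_; m*n/n≡m)
import Data.Nat.Properties as ℕ
open import Data.Product.Base using (∃; ∃₂; ∃-syntax; _×_; _,_; proj₁; proj₂)
open import Data.Sum.Base using (_⊎_; inj₁; inj₂; [_,_]′)
open import Data.Vec.Functional using (Vector; head; tail; _∷_; [])
import Data.Vec.Functional.Relation.Binary.Equality.Setoid
open import Defs
open import Function.Base using (_∘_; id)
open import Function.Bundles using (Inverse)
open import Function.Definitions using (Injective)
open import Level using (Level; _⊔_)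
open import Relation.Binary.Definitions using (Decidable)
open import Relation.Binary.PropositionalEquality as ≡ using (_≡_; _≢_)
import Relation.Binary.Reasoning.Setoid
open import Relation.Nullary.Decidable as Dec using (Dec; yes; no; ¬?; decidable-stable; dec⇒maybe)
open import Relation.Nullary.Negation using (¬_; contradiction)

-- The target form `f` is arbitrary, so it can be reached only through a classification of forms. In
-- linear ranks a quadric of type e in PG(m,q) has m + 1 = 2k + e, where k is the rank of a
-- generator; splitting off k hyperbolic planes therefore leaves an anisotropic form of rank e,
-- which is 0, 1 or 2. The classification is up to a scalar because for e = 1 the forms a T² and a′
-- T² need not be isometric; a nonzero scalar does not change the singular points. The graphs
-- account for the power of q in the size of a spread and ⟨ P , Π₀ ⟩ for the additional 1. Each lift
-- has rank at least k + 1, the Witt index of Q, and this makes it a generator. Subspaces are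
-- arbitrary predicates, for which membership is not decidable. Dimension arguments are therefore
-- carried out on injective linear maps F^k → F^n, whose zeros and images are decided by searching
-- the finite field.

-- The ring solver decides x - x ≈ 0# only if the coefficients compute, so they
-- are taken in ℤ rather than in the abstract ring.
module IntegerCoefficients {c ℓ} (R : CommutativeRing c ℓ) where
  open CommutativeRing R
  open Algebra.Properties.Ring ring
  open Algebra.Properties.Semiring.Mult semiring renaming (_×_ to infixr 8 _·_)
  open Relation.Binary.Reasoning.Setoid setoid

  ⟦_⟧ℤ : ℤ → Carrier
  ⟦ + n ⟧ℤ      = n · 1#
  ⟦ -[1+ n ] ⟧ℤ = - (suc n · 1#)

  ⟦⟧-cong : ∀ {i j} → i ≡ j → ⟦ i ⟧ℤ ≈ ⟦ j ⟧ℤ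
  ⟦⟧-cong ≡.refl = refl

  ⟦⟧-neg : ∀ i → ⟦ ℤ.- i ⟧ℤ ≈ - ⟦ i ⟧ℤ
  ⟦⟧-neg (+ zero)   = sym -0#≈0#
  ⟦⟧-neg (+ suc n)  = refl
  ⟦⟧-neg (-[1+ n ]) = sym (-‿involutive _)

  ⟦⟧-⊖ : ∀ m n → ⟦ m ⊖ n ⟧ℤ ≈ m · 1# - n · 1#
  ⟦⟧-⊖ zero    zero    = sym (-‿inverseʳ 0#)
  ⟦⟧-⊖ zero    (suc n) = sym (+-identityˡ _)
  ⟦⟧-⊖ (suc m) zero    = sym (trans (+-congˡ -0#≈0#) (+-identityʳ _))
  ⟦⟧-⊖ (suc m) (suc n) = begin
    ⟦ suc m ⊖ suc n ⟧ℤ                   ≈⟨ ⟦⟧-cong (ℤ.[1+m]⊖[1+n]≡m⊖n m n) ⟩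
    ⟦ m ⊖ n ⟧ℤ                           ≈⟨ ⟦⟧-⊖ m n ⟩
    m · 1# - n · 1#                      ≈⟨ +-congʳ (+-identityˡ _) ⟨
    0# + m · 1# - n · 1#                 ≈⟨ +-congʳ (+-congʳ (-‿inverseʳ 1#)) ⟨
    1# - 1# + m · 1# - n · 1#
      ≈⟨ +-congʳ (trans (+-assoc _ _ _) (trans (+-congˡ (+-comm _ _)) (sym (+-assoc _ _ _)))) ⟩
    1# + m · 1# - 1# - n · 1#            ≈⟨ +-assoc _ _ _ ⟩
    1# + m · 1# + (- 1# - n · 1#)        ≈⟨ +-congˡ (-‿+-comm 1# _) ⟩
    1# + m · 1# - (1# + n · 1#)          ∎

  ⟦⟧-+ : ∀ i j → ⟦ i ℤ.+ j ⟧ℤ ≈ ⟦ i ⟧ℤ + ⟦ j ⟧ℤ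
  ⟦⟧-+ (+ m)    (+ n)    = ×-homo-+ 1# m n
  ⟦⟧-+ (+ m)    -[1+ n ] = ⟦⟧-⊖ m (suc n)
  ⟦⟧-+ -[1+ m ] (+ n)    = trans (⟦⟧-⊖ n (suc m)) (+-comm _ _)
  ⟦⟧-+ -[1+ m ] -[1+ n ] = begin
    ⟦ -[1+ m ] ℤ.+ -[1+ n ] ⟧ℤ           ≈⟨ ⟦⟧-cong (ℤ.neg-distrib-+ (+ suc m) (+ suc n)) ⟨
    - ((suc m ℕ.+ suc n) · 1#)           ≈⟨ -‿cong (×-homo-+ 1# (suc m) (suc n)) ⟩
    - (suc m · 1# + suc n · 1#)          ≈⟨ -‿+-comm _ _ ⟨
    - (suc m · 1#) - suc n · 1#          ∎

  ⟦⟧-+* : ∀ m j → ⟦ + m ℤ.* j ⟧ℤ ≈ ⟦ + m ⟧ℤ * ⟦ j ⟧ℤ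
  ⟦⟧-+* m (+ n)    = trans (⟦⟧-cong (≡.sym (ℤ.pos-* m n))) (×1-homo-* m n)
  ⟦⟧-+* m -[1+ n ] = begin
    ⟦ + m ℤ.* -[1+ n ] ⟧ℤ                ≈⟨ ⟦⟧-cong (ℤ.neg-distribʳ-* (+ m) (+ suc n)) ⟨
    ⟦ ℤ.- (+ m ℤ.* + suc n) ⟧ℤ           ≈⟨ ⟦⟧-neg (+ m ℤ.* + suc n) ⟩
    - ⟦ + m ℤ.* + suc n ⟧ℤ               ≈⟨ -‿cong (⟦⟧-+* m (+ suc n)) ⟩
    - (m · 1# * (suc n · 1#))            ≈⟨ -‿distribʳ-* _ _ ⟩
    m · 1# * - (suc n · 1#)              ∎

  ⟦⟧-* : ∀ i j → ⟦ i ℤ.* j ⟧ℤ ≈ ⟦ i ⟧ℤ * ⟦ j ⟧ℤ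
  ⟦⟧-* (+ m)    j = ⟦⟧-+* m j
  ⟦⟧-* -[1+ m ] j = begin
    ⟦ -[1+ m ] ℤ.* j ⟧ℤ                  ≈⟨ ⟦⟧-cong (ℤ.neg-distribˡ-* (+ suc m) j) ⟨
    ⟦ ℤ.- (+ suc m ℤ.* j) ⟧ℤ             ≈⟨ ⟦⟧-neg (+ suc m ℤ.* j) ⟩
    - ⟦ + suc m ℤ.* j ⟧ℤ                 ≈⟨ -‿cong (⟦⟧-+* (suc m) j) ⟩
    - (suc m · 1# * ⟦ j ⟧ℤ)              ≈⟨ -‿distribˡ-* _ _ ⟩
    - (suc m · 1#) * ⟦ j ⟧ℤ              ∎

  homomorphism : ℤ.+-*-rawRing -Raw-AlmostCommutative⟶ fromCommutativeRing R
  homomorphism = record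
    { ⟦_⟧    = ⟦_⟧ℤ
    ; +-homo = ⟦⟧-+
    ; *-homo = ⟦⟧-*
    ; -‿homo = ⟦⟧-neg
    ; 0-homo = refl
    ; 1-homo = +-identityʳ 1#
    }

  open Algebra.Solver.Ring ℤ.+-*-rawRing (fromCommutativeRing R) homomorphism
    (λ i j → Maybe.map ⟦⟧-cong (dec⇒maybe (i ℤ.≟ j))) public

-- Linear algebra over a finite field, by search and coordinates.

module LinearAlgebra {c ℓ₁ ℓ₂ : Level} {q : ℕ} (F : FiniteField c ℓ₁ ℓ₂ q) where

  open FiniteField F using (heytingField; commutativeRing; enumeration) public
  open CommutativeRing commutativeRing public
    hiding (zero)
  open Algebra.Properties.Ring ring public
  open Data.Vec.Functional.Relation.Binary.Equality.Setoid setoid public using (_≋_; ≋-refl; ≋-sym; ≋-trans)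
  open Algebra.Properties.CommutativeMonoid.Sum +-commutativeMonoid public using (sum)
  open IntegerCoefficients commutativeRing public using (solve; _:=_; _:+_; _:*_; _:-_; :-_; con)
  open Relation.Binary.Reasoning.Setoid setoid public
  private module E = Inverse enumeration

  infix 4 _≉0
  _≉0 : Carrier → Set ℓ₁
  a ≉0 = ¬ a ≈ 0#

  from-injective : ∀ {a b} → E.from a ≡ E.from b → a ≈ b
  from-injective {a} {b} eq = trans (sym (E.strictlyInverseˡ a))
    (trans (reflexive (≡.cong E.to eq)) (E.strictlyInverseˡ b))

  -- A Heyting field need not have decidable equality; here it is inherited from `Fin q`, and all
  -- later case distinctions rest on it.
  _≟_ : Decidable _≈_
  a ≟ b = Dec.map′ from-injective E.from-cong (E.from a Fin.≟ E.from b)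

  -- Otherwise `0# - 0#` would be invertible and `0#` apart from itself.
  1≉0 : 1# ≉0
  1≉0 1≈0 = #-irrefl refl (invertible⇒# {0#} {0#}
    (0# , trans (zeroˡ _) (sym 1≈0) , trans (zeroʳ _) (sym 1≈0)))
    where open HeytingField heytingField using (#-irrefl; invertible⇒#)

  finite-search : ∀ {p} {P : Carrier → Set p} → (∀ {a b} → a ≈ b → P a → P b) →
                  (∀ a → Dec (P a)) → Dec (∃ P)
  finite-search resp P? = Dec.map′ (λ (i , p) → E.to i , p)
    (λ (a , p) → E.from a , resp (sym (E.strictlyInverseˡ a)) p)
    (Fin.any? (P? ∘ E.to))

  abstract
    -- Apartness from zero yields an inverse, but inequality does not yield
    -- apartness; the inverse is searched for instead.
    inverse : ∀ {a} → a ≉0 → ∃[ b ] a * b ≈ 1#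
    inverse {a} a≉0 with finite-search (λ eq → trans (*-congˡ (sym eq))) (λ b → (a * b) ≟ 1#)
    ... | yes found = found
    ... | no none   = contradiction (tight a 0# .proj₁ λ a#0 → none (invert (#⇒invertible a#0))) a≉0
      where
      open HeytingField heytingField using (tight; #⇒invertible)
      invert : ∃[ b ] (b * (a - 0#) ≈ 1# × (a - 0#) * b ≈ 1#) → ∃[ b ] a * b ≈ 1#
      invert (b , _ , eq) = b , trans (*-congʳ (sym (trans (+-congˡ -0#≈0#) (+-identityʳ a)))) eq

  integral : ∀ {a b} → a ≉0 → a * b ≈ 0# → b ≈ 0#
  integral {a} {b} a≉0 ab≈0 = let a⁻¹ , aa⁻¹≈1 = inverse a≉0 in begin
    b              ≈⟨ *-identityˡ b ⟨
    1# * b         ≈⟨ *-congʳ aa⁻¹≈1 ⟨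
    a * a⁻¹ * b    ≈⟨ solve 3 (λ a i b → a :* i :* b := i :* (a :* b)) refl a a⁻¹ b ⟩
    a⁻¹ * (a * b)  ≈⟨ *-congˡ ab≈0 ⟩
    a⁻¹ * 0#       ≈⟨ zeroʳ a⁻¹ ⟩
    0#             ∎

  V : ℕ → Set c
  V = Vector Carrier

  private
    variable
      k l m n : ℕ

  0ⱽ : V n
  0ⱽ _ = 0#

  infixl 6 _⊕_
  _⊕_ : V n → V n → V n
  (x ⊕ y) i = x i + y i

  infixr 7 _⊙_
  _⊙_ : Carrier → V n → V n
  (a ⊙ x) i = a * x i

  ∷-cong : ∀ {a b} {x y : V n} → a ≈ b → x ≋ y → (a ∷ x) ≋ (b ∷ y)
  ∷-cong a≈b x≋y zero    = a≈b
  ∷-cong a≈b x≋y (suc i) = x≋y i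

  ∷-η : (x : V (suc n)) → x ≋ head x ∷ tail x
  ∷-η x zero    = refl
  ∷-η x (suc i) = refl

  _≋?_ : (x y : V n) → Dec (x ≋ y)
  x ≋? y = Fin.all? λ i → x i ≟ y i

  -- Exhaustive search, one coordinate at a time. `P` has to respect `_≋_` because only vectors
  -- assembled with `_∷_` from enumerated scalars are tried.
  search : ∀ {p} n {P : V n → Set p} → (∀ {x y} → x ≋ y → P x → P y) →
           (∀ x → Dec (P x)) → Dec (∃ P)
  search zero    resp P? = Dec.map′ ([] ,_) (λ (x , p) → resp (λ ()) p) (P? [])
  search (suc n) resp P? = Dec.map′
    (λ (a , x , p) → a ∷ x , p)
    (λ (x , p) → head x , tail x , resp (∷-η x) p)
    (finite-search (λ a≈b (x , p) → x , resp (∷-cong a≈b ≋-refl) p) λ a →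
      search n (resp ∘ ∷-cong refl) (P? ∘ (a ∷_)))

  record IsFunctional (g : V m → Carrier) : Set (c ⊔ ℓ₁) where
    field
      cong  : ∀ {x y} → x ≋ y → g x ≈ g y
      add   : ∀ x y → g (x ⊕ y) ≈ g x + g y
      scale : ∀ a x → g (a ⊙ x) ≈ a * g x

    null : g 0ⱽ ≈ 0#
    null = begin
      g 0ⱽ         ≈⟨ cong (λ _ → sym (zeroˡ 0#)) ⟩
      g (0# ⊙ 0ⱽ)  ≈⟨ scale 0# 0ⱽ ⟩
      0# * g 0ⱽ    ≈⟨ zeroˡ _ ⟩
      0#           ∎

  open IsFunctional

  -- Stated coordinatewise, so that whatever holds for functionals applies to maps one coordinate at
  -- a time.
  IsLinear : (V m → V n) → Set (c ⊔ ℓ₁)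
  IsLinear M = ∀ i → IsFunctional λ x → M x i

  functional-resp : {g h : V m → Carrier} → (∀ x → g x ≈ h x) → IsFunctional g → IsFunctional h
  functional-resp g≈h G .cong x≋y  = trans (sym (g≈h _)) (trans (G .cong x≋y) (g≈h _))
  functional-resp g≈h G .add x y   = trans (sym (g≈h _)) (trans (G .add x y) (+-cong (g≈h x) (g≈h y)))
  functional-resp g≈h G .scale a x = trans (sym (g≈h _)) (trans (G .scale a x) (*-congˡ (g≈h x)))

  coordinate : (i : Fin m) → IsFunctional λ x → x i
  coordinate i .cong x≋y  = x≋y i
  coordinate i .add x y   = refl
  coordinate i .scale a x = refl

  zero-functional : IsFunctional {m} λ _ → 0#
  zero-functional .cong _    = refl
  zero-functional .add _ _   = sym (+-identityˡ 0#)
  zero-functional .scale a _ = sym (zeroʳ a)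

  +-functional : {g h : V m → Carrier} → IsFunctional g → IsFunctional h → IsFunctional λ x → g x + h x
  +-functional G H .cong x≋y  = +-cong (G .cong x≋y) (H .cong x≋y)
  +-functional {g = g} {h} G H .add x y = trans (+-cong (G .add x y) (H .add x y))
    (solve 4 (λ a b c d → a :+ b :+ (c :+ d) := a :+ c :+ (b :+ d)) refl (g x) (g y) (h x) (h y))
  +-functional G H .scale a x = trans (+-cong (G .scale a x) (H .scale a x)) (sym (distribˡ a _ _))

  *-functional : ∀ b {g : V m → Carrier} → IsFunctional g → IsFunctional λ x → b * g x
  *-functional b G .cong x≋y  = *-congˡ (G .cong x≋y)
  *-functional b G .add x y   = trans (*-congˡ (G .add x y)) (distribˡ b _ _)
  *-functional b {g} G .scale a x = trans (*-congˡ (G .scale a x))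
    (solve 3 (λ a b c → b :* (a :* c) := a :* (b :* c)) refl a b (g x))

  functional-* : ∀ b {g : V m → Carrier} → IsFunctional g → IsFunctional λ x → g x * b
  functional-* b G = functional-resp (λ x → *-comm b _) (*-functional b G)

  sum-functional : (g : V m → V k) → IsLinear g → IsFunctional λ x → sum (g x)
  sum-functional {k = zero}  g G = zero-functional
  sum-functional {k = suc _} g G = +-functional (G zero) (sum-functional (tail ∘ g) (G ∘ suc))

  functional-∘ : {g : V n → Carrier} {M : V m → V n} → IsFunctional g → IsLinear M → IsFunctional (g ∘ M)
  functional-∘ G M .cong x≋y  = G .cong λ i → M i .cong x≋y
  functional-∘ G M .add x y   = trans (G .cong λ i → M i .add x y) (G .add _ _)
  functional-∘ G M .scale a x = trans (G .cong λ i → M i .scale a x) (G .scale a _)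

  linear-∘ : {N : V n → V l} {M : V m → V n} → IsLinear N → IsLinear M → IsLinear (N ∘ M)
  linear-∘ N M i = functional-∘ (N i) M

  ∷-linear : {g : V m → Carrier} {M : V m → V n} → IsFunctional g → IsLinear M → IsLinear λ x → g x ∷ M x
  ∷-linear G M zero    = G
  ∷-linear G M (suc i) = M i

  tail-linear : IsLinear {suc m} tail
  tail-linear i = coordinate (suc i)

  0∷-linear : IsLinear {m} (0# ∷_)
  0∷-linear = ∷-linear zero-functional coordinate

  ⊕-linear : {M N : V m → V n} → IsLinear M → IsLinear N → IsLinear λ x → M x ⊕ N x
  ⊕-linear M N i = +-functional (M i) (N i)

  ⊙-linear : {g : V m → Carrier} → IsFunctional g → (y : V n) → IsLinear λ x → g x ⊙ y
  ⊙-linear G y i = functional-* (y i) G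

  e₀ : V (suc n)
  e₀ = 1# ∷ 0ⱽ

  functional-∷ : {g : V (suc m) → Carrier} → IsFunctional g → ∀ a x →
                 g (a ∷ x) ≈ a * g e₀ + g (0# ∷ x)
  functional-∷ {g = g} G a x = begin
    g (a ∷ x)                   ≈⟨ G .cong (λ where
                                     zero    → sym (trans (+-identityʳ _) (*-identityʳ a))
                                     (suc i) → sym (trans (+-congʳ (zeroʳ a)) (+-identityˡ _))) ⟩
    g (a ⊙ e₀ ⊕ (0# ∷ x))       ≈⟨ G .add _ _ ⟩
    g (a ⊙ e₀) + g (0# ∷ x)     ≈⟨ +-congʳ (G .scale a e₀) ⟩
    a * g e₀ + g (0# ∷ x)       ∎

  functional-split : {g : V (suc m) → Carrier} → IsFunctional g → ∀ x →
                     g x ≈ head x * g e₀ + g (0# ∷ tail x)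
  functional-split G x = trans (G .cong (∷-η x)) (functional-∷ G (head x) (tail x))

  abstract
    zero-or-not : {g : V m → Carrier} → IsFunctional g → (∀ x → g x ≈ 0#) ⊎ (∃[ x ] g x ≉0)
    zero-or-not {g = g} G with search _ (λ x≋y gx≉0 gy≈0 → gx≉0 (trans (G .cong x≋y) gy≈0)) (λ x → ¬? (g x ≟ 0#))
    ... | yes found = inj₂ found
    ... | no none   = inj₁ λ x → decidable-stable (g x ≟ 0#) λ gx≉0 → none (x , gx≉0)

  -- Says that the kernel of `g` has dimension `m` by giving coordinates on it, so that a problem
  -- restricted to the kernel is again a problem on some `V m`. The map `ρ` is defined everywhere,
  -- but inverts `ι` on the kernel only.
  record KernelCoordinates (g : V (suc m) → Carrier) : Set (c ⊔ ℓ₁) where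
    field
      ι        : V m → V (suc m)
      ρ        : V (suc m) → V m
      ι-linear : IsLinear ι
      ρ-linear : IsLinear ρ
      g∘ι      : ∀ y → g (ι y) ≈ 0#
      ρ∘ι      : ∀ y → ρ (ι y) ≋ y
      ι∘ρ      : ∀ {x} → g x ≈ 0# → ι (ρ x) ≋ x

    ι-injective : ∀ {y} → ι y ≋ 0ⱽ → y ≋ 0ⱽ
    ι-injective {y} ιy≋0 = ≋-trans (≋-sym (ρ∘ι y)) λ i →
      trans (ρ-linear i .cong ιy≋0) (null (ρ-linear i))

  abstract
    -- If `g e₀` is nonzero, the equation `g z ≈ 0#` can be solved for the head of `z`, and the tail
    -- is a coordinate system. Otherwise `g` ignores the head, which becomes a free coordinate, and
    -- the tail is treated by recursion.
    kernel : ∀ m {g : V (suc m) → Carrier} → IsFunctional g → ∀ x → g x ≉0 → KernelCoordinates g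
    kernel m {g} G x gx≉0 with g e₀ ≟ 0#
    kernel m {g} G x gx≉0 | no ge₀≉0 = let b , ge₀b≈1 = inverse ge₀≉0 in record
      { ι        = λ y → - b * g (0# ∷ y) ∷ y
      ; ρ        = tail
      ; ι-linear = ∷-linear (*-functional (- b) (functional-∘ G 0∷-linear)) coordinate
      ; ρ-linear = tail-linear
      ; g∘ι      = λ y → begin
          g (- b * g (0# ∷ y) ∷ y)                   ≈⟨ functional-∷ G _ y ⟩
          - b * g (0# ∷ y) * g e₀ + g (0# ∷ y)
            ≈⟨ solve 3 (λ b h e → (:- b) :* h :* e :+ h := h :- (e :* b) :* h) refl b (g (0# ∷ y)) (g e₀) ⟩
          g (0# ∷ y) - g e₀ * b * g (0# ∷ y)         ≈⟨ +-congˡ (-‿cong (trans (*-congʳ ge₀b≈1) (*-identityˡ _))) ⟩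
          g (0# ∷ y) - g (0# ∷ y)                    ≈⟨ -‿inverseʳ _ ⟩
          0#                                         ∎
      ; ρ∘ι      = λ y → ≋-refl
      ; ι∘ρ      = λ {z} gz≈0 → λ where
          (suc i) → refl
          zero    → begin
            - b * g (0# ∷ tail z)
              ≈⟨ solve 4 (λ b h e a → (:- b) :* h := a :* (e :* b) :- b :* (a :* e :+ h))
                   refl b (g (0# ∷ tail z)) (g e₀) (head z) ⟩
            head z * (g e₀ * b) - b * (head z * g e₀ + g (0# ∷ tail z))
              ≈⟨ +-cong (trans (*-congˡ ge₀b≈1) (*-identityʳ _)) (-‿cong (trans (*-congˡ (trans (sym (functional-split G z)) gz≈0)) (zeroʳ b))) ⟩
            head z - 0#   ≈⟨ trans (+-congˡ -0#≈0#) (+-identityʳ _) ⟩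
            head z        ∎
      }
    kernel m {g} G x gx≉0 | yes ge₀≈0 = drop-head m {x = x} G g≈ (λ eq → gx≉0 (trans (g≈ x) eq))
      where
      g≈ : ∀ z → g z ≈ g (0# ∷ tail z)
      g≈ z = trans (functional-split G z) (trans (+-congʳ (trans (*-congˡ ge₀≈0) (zeroʳ _))) (+-identityˡ _))
      drop-head : ∀ m {g : V (suc m) → Carrier} {x} → IsFunctional g → (∀ z → g z ≈ g (0# ∷ tail z)) →
             g (0# ∷ tail x) ≉0 → KernelCoordinates g
      drop-head zero    G _  g≉0 = contradiction (trans (G .cong λ where zero → refl) (null G)) g≉0
      drop-head (suc m) {g} G g≈ g≉0 = record
        { ι        = λ y → head y ∷ K.ι (tail y)
        ; ρ        = λ z → head z ∷ K.ρ (tail z)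
        ; ι-linear = ∷-linear (coordinate zero) (linear-∘ K.ι-linear tail-linear)
        ; ρ-linear = ∷-linear (coordinate zero) (linear-∘ K.ρ-linear tail-linear)
        ; g∘ι      = λ y → trans (g≈ _) (K.g∘ι (tail y))
        ; ρ∘ι      = λ y → ≋-trans (∷-cong refl (K.ρ∘ι (tail y))) (≋-sym (∷-η y))
        ; ι∘ρ      = λ {z} gz≈0 → ≋-trans (∷-cong refl (K.ι∘ρ (trans (sym (g≈ z)) gz≈0))) (≋-sym (∷-η z))
        }
        where module K = KernelCoordinates (kernel m (functional-∘ G 0∷-linear) _ g≉0)

  Injective₀ : (V m → V n) → Set (c ⊔ ℓ₁)
  Injective₀ M = ∀ {x} → M x ≋ 0ⱽ → x ≋ 0ⱽ

  rank-bound : ∀ l {M : V k → V l} → IsLinear M → Injective₀ M → k ℕ.≤ l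
  rank-bound {zero}  l       M inj = z≤n
  rank-bound {suc k} zero    M inj = contradiction (inj {e₀} (λ ()) zero) 1≉0
  rank-bound {suc k} (suc l) M inj with zero-or-not (M zero)
  ... | inj₁ null       = ℕ.m≤n⇒m≤1+n (rank-bound l (M ∘ suc) λ {x} eq →
                            inj λ where zero → null x; (suc i) → eq i)
  ... | inj₂ (x , hx≉0) = s≤s (rank-bound l (linear-∘ (M ∘ suc) K.ι-linear) λ {y} eq →
                            K.ι-injective (inj λ where zero → K.g∘ι y; (suc i) → eq i))
    where module K = KernelCoordinates (kernel k (M zero) x hx≉0)

  -- In a relation `h y + M t = 0` with `h` nonzero one could divide by `h`, which would put `y` in
  -- the image of `M`.
  extend-injective : {M : V m → V n} → IsLinear M → Injective₀ M → ∀ y → ¬ (∃[ x ] M x ≋ y) →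
                     Injective₀ λ z → head z ⊙ y ⊕ M (tail z)
  extend-injective {M = M} L inj y y∉ {z} eq with head z ≟ 0#
  ... | yes h≈0 = λ where
      zero    → h≈0
      (suc i) → inj {tail z} (λ j → trans (sym (trans (+-congʳ (trans (*-congʳ h≈0) (zeroˡ _))) (+-identityˡ _))) (eq j)) i
  ... | no h≉0 = let b , hb≈1 = inverse h≉0 in contradiction
      ((- b) ⊙ tail z , λ j → begin
        M ((- b) ⊙ tail z) j            ≈⟨ L j .scale (- b) (tail z) ⟩
        - b * M (tail z) j
          ≈⟨ solve 4 (λ b t h y → (:- b) :* t := h :* b :* y :- b :* (h :* y :+ t))
               refl b (M (tail z) j) (head z) (y j) ⟩
        head z * b * y j - b * (head z * y j + M (tail z) j)
          ≈⟨ +-cong (trans (*-congʳ hb≈1) (*-identityˡ _)) (trans (-‿cong (trans (*-congˡ (eq j)) (zeroʳ b))) -0#≈0#) ⟩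
        y j + 0#                        ≈⟨ +-identityʳ _ ⟩
        y j                             ∎) y∉

  extend-linear : {M : V m → V n} → IsLinear M → ∀ y → IsLinear λ z → head z ⊙ y ⊕ M (tail z)
  extend-linear L y = ⊕-linear (⊙-linear (coordinate zero) y) (linear-∘ L tail-linear)

  image? : {M : V m → V n} → IsLinear M → ∀ y → Dec (∃[ x ] M x ≋ y)
  image? {M = M} L y = search _ (λ x≋x′ Mx≋y j → trans (L j .cong (≋-sym x≋x′)) (Mx≋y j)) λ x → M x ≋? y

  record LinearInverse (M : V n → V n) : Set (c ⊔ ℓ₁) where
    field
      N        : V n → V n
      N-linear : IsLinear N
      M∘N      : ∀ y → M (N y) ≋ y
      N∘M      : ∀ x → N (M x) ≋ x

  injective-≋ : {M : V m → V n} → IsLinear M → Injective₀ M → ∀ {x y} → M x ≋ M y → x ≋ y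
  injective-≋ {M = M} L inj {x} {y} Mx≋My i = begin
    x i                   ≈⟨ solve 2 (λ x y → x := x :- y :+ y) refl (x i) (y i) ⟩
    x i - y i + y i       ≈⟨ +-congʳ (+-congˡ (-1*x≈-x (y i))) ⟨
    x i + - 1# * y i + y i ≈⟨ +-congʳ (inj difference i) ⟩
    0# + y i              ≈⟨ +-identityˡ _ ⟩
    y i                   ∎
    where
    difference : M (x ⊕ - 1# ⊙ y) ≋ 0ⱽ
    difference j = begin
      M (x ⊕ - 1# ⊙ y) j         ≈⟨ L j .add _ _ ⟩
      M x j + M (- 1# ⊙ y) j     ≈⟨ +-cong (Mx≋My j) (trans (L j .scale _ y) (-1*x≈-x _)) ⟩
      M y j - M y j              ≈⟨ -‿inverseʳ _ ⟩
      0#                         ∎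

  -- Preimages found by a search or by a spanning property form a bare function `g`. Since `N` is
  -- injective they are unique, and uniqueness forces linearity.
  lift-linear : {M : V m → V n} {N : V k → V n} → IsLinear M → IsLinear N → Injective₀ N →
                {g : V m → V k} → (∀ x → N (g x) ≋ M x) → IsLinear g
  lift-linear {M = M} {N} L L′ inj {g} Ng≋M i = record
    { cong  = λ {x} {y} x≋y → unique (λ j → trans (Ng≋M x j) (trans (L j .cong x≋y) (sym (Ng≋M y j)))) i
    ; add   = λ x y → unique (λ j → begin
        N (g (x ⊕ y)) j          ≈⟨ trans (Ng≋M (x ⊕ y) j) (L j .add x y) ⟩
        M x j + M y j            ≈⟨ +-cong (Ng≋M x j) (Ng≋M y j) ⟨
        N (g x) j + N (g y) j    ≈⟨ L′ j .add _ _ ⟨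
        N (g x ⊕ g y) j          ∎) i
    ; scale = λ a x → unique (λ j → begin
        N (g (a ⊙ x)) j          ≈⟨ trans (Ng≋M (a ⊙ x) j) (L j .scale a x) ⟩
        a * M x j                ≈⟨ *-congˡ (Ng≋M x j) ⟨
        a * N (g x) j            ≈⟨ L′ j .scale a _ ⟨
        N (a ⊙ g x) j            ∎) i
    }
    where
    unique : ∀ {x y} → N x ≋ N y → x ≋ y
    unique = injective-≋ L′ inj

  linear-inverse : {M : V n → V n} → IsLinear M → Injective₀ M → LinearInverse M
  linear-inverse {n} {M} L inj = record
    { N        = N
    ; N-linear = lift-linear coordinate L inj M∘N
    ; M∘N      = M∘N
    ; N∘M      = λ x → injective-≋ L inj (M∘N (M x))
    }
    where
    surjective : ∀ y → ∃[ x ] M x ≋ y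
    surjective y with image? L y
    ... | yes found = found
    -- A missed `y` would extend `M` to an injective map from rank `suc n` to rank `n`.
    ... | no y∉     = contradiction (rank-bound n (extend-linear L y) (extend-injective L inj y y∉)) ℕ.1+n≰n

    N = proj₁ ∘ surjective

    M∘N : ∀ y → M (N y) ≋ y
    M∘N = proj₂ ∘ surjective

-- Pigeonhole arguments and irreducible quadratic polynomials.

injective⇒surjective : ∀ {n} {f : Fin n → Fin n} → Injective _≡_ _≡_ f → ∀ j → ∃[ i ] f i ≡ j
injective⇒surjective {suc n} {f} inj j with Fin.any? (λ i → f i Fin.≟ j)
... | yes found = found
-- Punching out the missed value `j` would inject `Fin (suc n)` into `Fin n`.
... | no missed = contradiction (Fin.injective⇒≤ {f = λ i → punchOut (j≢f i)} λ {i} {i′} eq →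
                    inj (Fin.punchOut-injective (j≢f i) (j≢f i′) eq)) ℕ.1+n≰n
  where
  j≢f : ∀ i → j ≢ f i
  j≢f i j≡fi = missed (i , ≡.sym j≡fi)

module QuadraticPolynomials {c ℓ₁ ℓ₂ : Level} {q : ℕ} (F : FiniteField c ℓ₁ ℓ₂ q) where

  open LinearAlgebra F
  private module E = Inverse enumeration

  finite-surjective : ∀ {g : Carrier → Carrier} → (∀ {x y} → g x ≈ g y → x ≈ y) → ∀ z → ∃[ x ] g x ≈ z
  finite-surjective {g} inj z =
    let i , eq = injective⇒surjective {f = E.from ∘ g ∘ E.to} to-injective (E.from z)
    in E.to i , from-injective eq
    where
    to-injective : Injective _≡_ _≡_ (E.from ∘ g ∘ E.to)
    to-injective {i} {j} eq = ≡.trans (≡.sym (E.strictlyInverseʳ i))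
      (≡.trans (E.from-cong (inj (from-injective eq))) (E.strictlyInverseʳ j))

  -- The fibres of N are the orbits of the involution σ, and τ N takes values
  -- outside N except at fixed points of σ. Applying N to one point of each
  -- orbit and τ N to the other is then injective, hence onto.
  dichotomy : (N σ τ : Carrier → Carrier) → (∀ {x y} → x ≈ y → σ x ≈ σ y) → (∀ x → σ (σ x) ≈ x) →
              (∀ {x y} → τ x ≈ τ y → x ≈ y) →
              (∀ {x y} → N x ≈ N y → y ≈ x ⊎ y ≈ σ x) →
              (∀ {x y} → N x ≈ τ (N y) → σ y ≈ y) →
              ∀ z → (∃[ x ] N x ≈ z) ⊎ (∃[ x ] τ (N x) ≈ z)
  dichotomy N σ τ σ-cong σσ τ-inj fibre apart z =
    let x , eq = finite-surjective {g = λ x → choose x (first? x)} (λ {x} {y} → choose-injective x y (first? x) (first? y)) z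
    in split x (first? x) eq
    where
    -- The enumeration order picks one point of each orbit; a fixed point of `σ` always counts as
    -- `First`.
    First : Carrier → Set
    First x = E.from x Fin.≤ E.from (σ x)

    first? : ∀ x → Dec (First x)
    first? x = E.from x Fin.≤? E.from (σ x)

    choose : ∀ x → Dec (First x) → Carrier
    choose x (yes _) = N x
    choose x (no _)  = τ (N x)

    split : ∀ x (d : Dec (First x)) → choose x d ≈ z → (∃[ x ] N x ≈ z) ⊎ (∃[ x ] τ (N x) ≈ z)
    split x (yes _) eq = inj₁ (x , eq)
    split x (no _)  eq = inj₂ (x , eq)

    swapped : ∀ x y → y ≈ σ x → E.from y ≡ E.from (σ x) × E.from (σ y) ≡ E.from x
    swapped x y y≈σx = E.from-cong y≈σx , E.from-cong (trans (σ-cong y≈σx) (σσ x))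

    ordered : ∀ x → ¬ First x → x ≈ σ x → ∀ {a} {A : Set a} → A
    ordered x ¬first eq = contradiction (Fin.≤-reflexive (E.from-cong eq)) ¬first

    choose-injective : ∀ x y (d : Dec (First x)) (d′ : Dec (First y)) → choose x d ≈ choose y d′ → x ≈ y
    choose-injective x y (yes p) (yes p′) eq with fibre eq
    ... | inj₁ y≈x  = sym y≈x
    -- `x` and `y` are exchanged by `σ` and each precedes its image, so their indices agree.
    ... | inj₂ y≈σx = let e , e′ = swapped x y y≈σx in from-injective {x} {y} (Fin.≤-antisym
            (≡.subst (E.from x Fin.≤_) (≡.sym e) p) (≡.subst (E.from y Fin.≤_) e′ p′))
    -- Equal values here would make `y` a fixed point of `σ`, hence `First`.
    choose-injective x y (yes p) (no ¬p) eq = ordered y ¬p (sym (apart eq))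
    choose-injective x y (no ¬p) (yes p) eq = ordered x ¬p (sym (apart (sym eq)))
    choose-injective x y (no ¬p) (no ¬p′) eq with fibre (τ-inj eq)
    ... | inj₁ y≈x  = sym y≈x
    ... | inj₂ y≈σx = let e , e′ = swapped x y y≈σx in contradiction
            (≡.subst₂ Fin._≤_ (≡.sym e) (≡.sym e′) (ℕ.<⇒≤ (ℕ.≰⇒> ¬p))) ¬p′

  -≈0 : ∀ {x y} → x - y ≈ 0# → x ≈ y
  -≈0 {x} {y} eq = begin
    x          ≈⟨ solve 2 (λ x y → x := x :- y :+ y) refl x y ⟩
    x - y + y  ≈⟨ +-congʳ eq ⟩
    0# + y     ≈⟨ +-identityˡ y ⟩
    y          ∎

  ≈-0 : ∀ {x y} → x ≈ y → x - y ≈ 0#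
  ≈-0 {x} {y} x≈y = trans (+-congʳ x≈y) (-‿inverseʳ y)

  cancel : ∀ {a x y} → a ≉0 → a * x ≈ a * y → x ≈ y
  cancel {a} {x} {y} a≉0 eq = -≈0 (integral a≉0 (trans
    (solve 3 (λ a x y → a :* (x :- y) := a :* x :- a :* y) refl a x y) (≈-0 eq)))

  zero-product : ∀ {a b} → a * b ≈ 0# → a ≈ 0# ⊎ b ≈ 0#
  zero-product {a} ab≈0 with a ≟ 0#
  ... | yes a≈0 = inj₁ a≈0
  ... | no a≉0  = inj₂ (integral a≉0 ab≈0)

  -- Anisotropy of T² + β T U + γ U², tested at U = 1; at U = 0 only T² remains.
  NoRoot : Carrier → Carrier → Set (c ⊔ ℓ₁)
  NoRoot β γ = ∀ t → (t * t + β * t + γ) ≉0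

  -- T² + β T U + γ U² arises from T² + β′ T U + γ′ U² by substituting
  -- (T + v U , s U) for (T , U).
  Equivalent : (β γ β′ γ′ : Carrier) → Set (c ⊔ ℓ₁)
  Equivalent β γ β′ γ′ = ∃₂ λ v s →
    β′ * s + (v + v) ≈ β × v * v + β′ * (v * s) + γ′ * (s * s) ≈ γ

  module OddCharacteristic (2≉0 : (1# + 1#) ≉0) where

    double-cancel : ∀ {x y} → x + x ≈ y + y → x ≈ y
    double-cancel {x} {y} eq = cancel 2≉0 (trans (double x) (trans eq (sym (double y))))
      where
      double : ∀ x → (1# + 1#) * x ≈ x + x
      double x = trans (distribʳ x 1# 1#) (+-cong (*-identityˡ x) (*-identityˡ x))

    halve : ∀ w → ∃[ v ] v + v ≈ w
    halve w = let h , 2h≈1 = inverse 2≉0 in h * w , (begin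
      h * w + h * w            ≈⟨ +-cong (*-identityˡ _) (*-identityˡ _) ⟨
      1# * (h * w) + 1# * (h * w) ≈⟨ distribʳ _ _ _ ⟨
      (1# + 1#) * (h * w)      ≈⟨ *-assoc _ _ _ ⟨
      (1# + 1#) * h * w        ≈⟨ *-congʳ 2h≈1 ⟩
      1# * w                   ≈⟨ *-identityˡ w ⟩
      w                        ∎)

    discriminant : Carrier → Carrier → Carrier
    discriminant β γ = β * β - (γ + γ + (γ + γ))

    quadruple-cancel : ∀ {x y} → x + x + (x + x) ≈ y + y + (y + y) → x ≈ y
    quadruple-cancel eq = double-cancel (double-cancel eq)

    -- The quadratic formula: a square root `x` of the discriminant would give the root
    -- `(x - β) / 2`. The computation is done for four times the polynomial.
    nonsquare : ∀ {β γ} → NoRoot β γ → ∀ x → ¬ x * x ≈ discriminant β γ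
    nonsquare {β} {γ} no-root x eq = let t , 2t≈x-β = halve (x - β) in
      no-root t (quadruple-cancel (begin
        (t * t + β * t + γ) + (t * t + β * t + γ) + ((t * t + β * t + γ) + (t * t + β * t + γ))
          ≈⟨ solve 3 (λ t b c → let f = t :* t :+ b :* t :+ c in
               f :+ f :+ (f :+ f) := (t :+ t :+ b) :* (t :+ t :+ b) :- (b :* b :- (c :+ c :+ (c :+ c)))) refl t β γ ⟩
        (t + t + β) * (t + t + β) - discriminant β γ
          ≈⟨ +-congʳ (*-cong (+-congʳ 2t≈x-β) (+-congʳ 2t≈x-β)) ⟩
        (x - β + β) * (x - β + β) - discriminant β γ
          ≈⟨ +-congʳ (solve 2 (λ x b → (x :- b :+ b) :* (x :- b :+ b) := x :* x) refl x β) ⟩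
        x * x - discriminant β γ
          ≈⟨ ≈-0 eq ⟩
        0#
          ≈⟨ solve 0 (con (+ 0) := con (+ 0) :+ con (+ 0) :+ (con (+ 0) :+ con (+ 0))) refl ⟩
        0# + 0# + (0# + 0#) ∎))

    module _ {d} (d-nonsquare : ∀ x → ¬ x * x ≈ d) where

      nonsquare≉0 : d ≉0
      nonsquare≉0 d≈0 = d-nonsquare 0# (trans (zeroˡ 0#) (sym d≈0))

      -- Squaring has the fibres {x, -x}, and `x² = d y²` with `y` nonzero would make `d` a square.
      -- So `dichotomy` applies with negation for `σ` and multiplication by `d` for `τ`.
      square-class : ∀ z → (∃[ x ] x * x ≈ z) ⊎ (∃[ x ] d * (x * x) ≈ z)
      square-class = dichotomy (λ x → x * x) -_ (d *_) -‿cong -‿involutive (cancel nonsquare≉0) fibre apart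
        where
        fibre : ∀ {x y} → x * x ≈ y * y → y ≈ x ⊎ y ≈ - x
        fibre {x} {y} eq with zero-product {y - x} {y + x} (trans
          (solve 2 (λ x y → (y :- x) :* (y :+ x) := y :* y :- x :* x) refl x y) (≈-0 (sym eq)))
        ... | inj₁ y-x≈0 = inj₁ (-≈0 y-x≈0)
        ... | inj₂ y+x≈0 = inj₂ (-≈0 (trans (+-congˡ (-‿involutive x)) y+x≈0))

        apart : ∀ {x y} → x * x ≈ d * (y * y) → - y ≈ y
        apart {x} {y} eq with y ≟ 0#
        ... | yes y≈0 = trans (-‿cong y≈0) (trans -0#≈0# (sym y≈0))
        ... | no y≉0  = let i , yi≈1 = inverse y≉0 in contradiction (begin
          (x * i) * (x * i)      ≈⟨ solve 2 (λ x i → (x :* i) :* (x :* i) := x :* x :* (i :* i)) refl x i ⟩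
          x * x * (i * i)        ≈⟨ *-congʳ eq ⟩
          d * (y * y) * (i * i)
            ≈⟨ solve 3 (λ d y i → d :* (y :* y) :* (i :* i) := d :* ((y :* i) :* (y :* i))) refl d y i ⟩
          d * ((y * i) * (y * i)) ≈⟨ *-congˡ (trans (*-cong yi≈1 yi≈1) (*-identityʳ 1#)) ⟩
          d * 1#                 ≈⟨ *-identityʳ d ⟩
          d                      ∎) (d-nonsquare (x * i))

    -- Four times the left side is `(2 v + β′ s)²` minus the discriminant times `s²`.
    complete-square : ∀ {β γ β′ γ′ v s} → v + v ≈ β - β′ * s → discriminant β′ γ′ * (s * s) ≈ discriminant β γ →
                      v * v + β′ * (v * s) + γ′ * (s * s) ≈ γ
    complete-square {β} {γ} {β′} {γ′} {v} {s} 2v≈ eq = quadruple-cancel (begin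
      (v * v + β′ * (v * s) + γ′ * (s * s)) + (v * v + β′ * (v * s) + γ′ * (s * s)) +
      ((v * v + β′ * (v * s) + γ′ * (s * s)) + (v * v + β′ * (v * s) + γ′ * (s * s)))
        ≈⟨ solve 4 (λ v s b c → let f = v :* v :+ b :* (v :* s) :+ c :* (s :* s) in
             f :+ f :+ (f :+ f) := (v :+ v :+ b :* s) :* (v :+ v :+ b :* s) :- (b :* b :- (c :+ c :+ (c :+ c))) :* (s :* s))
             refl v s β′ γ′ ⟩
      (v + v + β′ * s) * (v + v + β′ * s) - discriminant β′ γ′ * (s * s)
        ≈⟨ +-cong (*-cong (+-congʳ 2v≈) (+-congʳ 2v≈)) (-‿cong eq) ⟩
      (β - β′ * s + β′ * s) * (β - β′ * s + β′ * s) - discriminant β γ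
        ≈⟨ solve 3 (λ b e c → (b :- e :+ e) :* (b :- e :+ e) :- (b :* b :- (c :+ c :+ (c :+ c))) := c :+ c :+ (c :+ c))
             refl β (β′ * s) γ ⟩
      γ + γ + (γ + γ) ∎)

    -- Both discriminants are nonsquares, so their quotient is a square `s²`. The middle coefficient
    -- then determines `v`, and the constant term comes out right by completing the square.
    equivalent : ∀ {β γ β′ γ′} → NoRoot β γ → NoRoot β′ γ′ → Equivalent β γ β′ γ′
    equivalent {β} {γ} {β′} {γ′} no-root no-root′ =
      [ (λ (x , eq) → contradiction eq (nonsquare no-root x))
      , (λ (s , eq) → let v , 2v≈ = halve (β - β′ * s) in v , s ,
          trans (+-congˡ 2v≈) (solve 2 (λ b c → c :+ (b :- c) := b) refl β (β′ * s)) ,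
          complete-square 2v≈ eq)
      ]′ (square-class (nonsquare no-root′) (discriminant β γ))

  module EvenCharacteristic (2≈0 : 1# + 1# ≈ 0#) where

    double : ∀ x → x + x ≈ 0#
    double x = begin
      x + x            ≈⟨ +-cong (*-identityʳ x) (*-identityʳ x) ⟨
      x * 1# + x * 1#  ≈⟨ distribˡ x 1# 1# ⟨
      x * (1# + 1#)    ≈⟨ trans (*-congˡ 2≈0) (zeroʳ x) ⟩
      0#               ∎

    +≈0 : ∀ {x y} → x + y ≈ 0# → x ≈ y
    +≈0 {x} {y} eq = begin
      x              ≈⟨ +-identityʳ x ⟨
      x + 0#         ≈⟨ +-congˡ (double y) ⟨
      x + (y + y)    ≈⟨ +-assoc x y y ⟨
      x + y + y      ≈⟨ trans (+-congʳ eq) (+-identityˡ y) ⟩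
      y              ∎

    ≈+0 : ∀ {x y} → x ≈ y → x + y ≈ 0#
    ≈+0 {x} {y} x≈y = trans (+-congʳ x≈y) (double y)

    -- Frobenius: in characteristic 2 the square of a sum has no cross term.
    square-injective : ∀ {x y} → x * x ≈ y * y → x ≈ y
    square-injective {x} {y} eq with zero-product (begin
        (x + y) * (x + y)
          ≈⟨ solve 2 (λ x y → (x :+ y) :* (x :+ y) := x :* x :+ y :* y :+ (x :* y :+ x :* y)) refl x y ⟩
        x * x + y * y + (x * y + x * y) ≈⟨ +-cong (≈+0 eq) (double _) ⟩
        0# + 0#                      ≈⟨ +-identityˡ 0# ⟩
        0#                           ∎)
    ... | inj₁ x+y≈0 = +≈0 x+y≈0
    ... | inj₂ x+y≈0 = +≈0 x+y≈0

    -- Squaring is injective, hence onto a finite field, so T² + γ always has a root.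
    middle≉0 : ∀ {β γ} → NoRoot β γ → β ≉0
    middle≉0 {β} {γ} no-root β≈0 = let t , t²≈γ = finite-surjective square-injective γ in no-root t (begin
      t * t + β * t + γ  ≈⟨ +-congʳ (trans (+-congˡ (trans (*-congʳ β≈0) (zeroˡ t))) (+-identityʳ _)) ⟩
      t * t + γ          ≈⟨ ≈+0 t²≈γ ⟩
      0#                 ∎)

    module _ {d} (no-root : ∀ u → ¬ u * u + u ≈ d) where

      -- The additive counterpart of the square classes: `u² + u` is additive in `u` with kernel {0,
      -- 1}, so its values form a subgroup of index two, and `d` represents the other coset. If
      -- values in the two cosets agreed, the sum of their arguments would solve `u² + u = d`.
      artin-schreier-class : ∀ z → (∃[ u ] u * u + u ≈ z) ⊎ (∃[ u ] u * u + u + d ≈ z)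
      artin-schreier-class = dichotomy (λ u → u * u + u) (_+ 1#) (_+ d) +-congʳ
        (λ x → trans (+-assoc x 1# 1#) (trans (+-congˡ 2≈0) (+-identityʳ x)))
        (λ eq → +-cancelʳ _ _ _ eq) fibre apart
        where
        fibre : ∀ {x y} → x * x + x ≈ y * y + y → y ≈ x ⊎ y ≈ x + 1#
        fibre {x} {y} eq with zero-product {y - x} {y + (x + 1#)} (begin
            (y - x) * (y + (x + 1#))
              ≈⟨ solve 3 (λ x y e → (y :- x) :* (y :+ (x :+ e)) := y :* y :- x :* x :+ (y :- x) :* e) refl x y 1# ⟩
            y * y - x * x + (y - x) * 1#
              ≈⟨ +-congˡ (*-identityʳ _) ⟩
            y * y - x * x + (y - x)
              ≈⟨ solve 2 (λ x y → y :* y :- x :* x :+ (y :- x) := y :* y :+ y :- (x :* x :+ x)) refl x y ⟩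
            y * y + y - (x * x + x)
              ≈⟨ ≈-0 (sym eq) ⟩
            0# ∎)
        ... | inj₁ y-x≈0 = inj₁ (-≈0 y-x≈0)
        ... | inj₂ eq′   = inj₂ (+≈0 eq′)

        apart : ∀ {x y} → x * x + x ≈ y * y + y + d → y + 1# ≈ y
        apart {x} {y} eq = contradiction (begin
          (x + y) * (x + y) + (x + y)
            ≈⟨ solve 2 (λ x y → (x :+ y) :* (x :+ y) :+ (x :+ y) := x :* x :+ x :+ (y :* y :+ y) :+ (x :* y :+ x :* y))
                 refl x y ⟩
          x * x + x + (y * y + y) + (x * y + x * y)
            ≈⟨ +-cong (+-congʳ eq) (double _) ⟩
          y * y + y + d + (y * y + y) + 0#
            ≈⟨ solve 2 (λ n d → n :+ d :+ n :+ con (+ 0) := n :+ n :+ d) refl (y * y + y) d ⟩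
          y * y + y + (y * y + y) + d
            ≈⟨ trans (+-congʳ (double _)) (+-identityˡ d) ⟩
          d ∎) (no-root (x + y))

    unscale : ∀ {β γ k} → β * k ≈ 1# → β * β * (γ * (k * k)) ≈ γ
    unscale {β} {γ} {k} βk≈1 = begin
      β * β * (γ * (k * k))
        ≈⟨ solve 3 (λ b c k → b :* b :* (c :* (k :* k)) := c :* ((b :* k) :* (b :* k))) refl β γ k ⟩
      γ * ((β * k) * (β * k))  ≈⟨ *-congˡ (trans (*-cong βk≈1 βk≈1) (*-identityʳ 1#)) ⟩
      γ * 1#                   ≈⟨ *-identityʳ γ ⟩
      γ                        ∎

    -- T² + β T + γ becomes β² (U² + U + γ k²) for T = β U and k = β⁻¹.
    reduced-no-root : ∀ {β γ} → NoRoot β γ → ∀ {k} → β * k ≈ 1# → ∀ u → ¬ u * u + u ≈ γ * (k * k)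
    reduced-no-root {β} {γ} no-root {k} βk≈1 u eq = no-root (β * u) (begin
      (β * u) * (β * u) + β * (β * u) + γ
        ≈⟨ solve 3 (λ b u c → (b :* u) :* (b :* u) :+ b :* (b :* u) :+ c := b :* b :* (u :* u :+ u) :+ c) refl β u γ ⟩
      β * β * (u * u + u) + γ
        ≈⟨ +-congʳ (trans (*-congˡ eq) (unscale βk≈1)) ⟩
      γ + γ
        ≈⟨ double γ ⟩
      0# ∎)

    -- Once both polynomials are scaled to middle coefficient 1, the substitution is the translation
    -- by `u`. Undoing the two scalings gives `v = β u` and `s = β k′ = β / β′`.
    transport-root : ∀ {β γ β′ γ′ k k′ u} → β * k ≈ 1# → β′ * k′ ≈ 1# →
                     u * u + u + γ′ * (k′ * k′) ≈ γ * (k * k) →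
                     β * u * (β * u) + β′ * (β * u * (β * k′)) + γ′ * (β * k′ * (β * k′)) ≈ γ
    transport-root {β} {γ} {β′} {γ′} {k} {k′} {u} βk≈1 β′k′≈1 eq = begin
      β * u * (β * u) + β′ * (β * u * (β * k′)) + γ′ * (β * k′ * (β * k′))
        ≈⟨ solve 5 (λ b u b′ k′ c′ →
             b :* u :* (b :* u) :+ b′ :* (b :* u :* (b :* k′)) :+ c′ :* (b :* k′ :* (b :* k′))
             := b :* b :* (u :* u :+ (b′ :* k′) :* u :+ c′ :* (k′ :* k′))) refl β u β′ k′ γ′ ⟩
      β * β * (u * u + (β′ * k′) * u + γ′ * (k′ * k′))
        ≈⟨ *-congˡ (+-congʳ (+-congˡ (trans (*-congʳ β′k′≈1) (*-identityˡ u)))) ⟩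
      β * β * (u * u + u + γ′ * (k′ * k′))
        ≈⟨ *-congˡ eq ⟩
      β * β * (γ * (k * k))
        ≈⟨ unscale βk≈1 ⟩
      γ ∎

    transport-middle : ∀ {β β′ k′} → β′ * k′ ≈ 1# → ∀ u → β′ * (β * k′) + (β * u + β * u) ≈ β
    transport-middle {β} {β′} {k′} β′k′≈1 u = begin
      β′ * (β * k′) + (β * u + β * u)  ≈⟨ trans (+-congˡ (double _)) (+-identityʳ _) ⟩
      β′ * (β * k′)                    ≈⟨ solve 3 (λ a b k → a :* (b :* k) := b :* (a :* k)) refl β′ β k′ ⟩
      β * (β′ * k′)                    ≈⟨ trans (*-congˡ β′k′≈1) (*-identityʳ β) ⟩
      β                                ∎

    -- The invariant is γ / β² modulo the values `u² + u` (the Arf invariant). For both polynomials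
    -- it is the nontrivial class, so the two constants differ by some `u² + u`.
    equivalent : ∀ {β γ β′ γ′} → NoRoot β γ → NoRoot β′ γ′ → Equivalent β γ β′ γ′
    equivalent {β} {γ} {β′} {γ′} no-root no-root′ =
      let k  , βk≈1   = inverse (middle≉0 no-root)
          k′ , β′k′≈1 = inverse (middle≉0 no-root′)
      in [ (λ (u , eq) → contradiction eq (reduced-no-root no-root βk≈1 u))
         , (λ (u , eq) → β * u , β * k′ , transport-middle β′k′≈1 u , transport-root βk≈1 β′k′≈1 eq)
         ]′ (artin-schreier-class (reduced-no-root no-root′ β′k′≈1) (γ * (k * k)))

  equivalent : ∀ {β γ β′ γ′} → NoRoot β γ → NoRoot β′ γ′ → Equivalent β γ β′ γ′
  equivalent with (1# + 1#) ≟ 0#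
  ... | yes 2≈0 = EvenCharacteristic.equivalent 2≈0
  ... | no 2≉0  = OddCharacteristic.equivalent 2≉0

-- Quadratic forms, totally singular subspaces and hyperbolic splittings.

module QuadraticSpaces {c ℓ₁ ℓ₂ : Level} {q : ℕ} (F : FiniteField c ℓ₁ ℓ₂ q) where

  open LinearAlgebra F
  open QuadraticPolynomials F
  open IsFunctional

  private
    variable
      k l m n : ℕ

  polarization : (V m → Carrier) → V m → V m → Carrier
  polarization Q x y = Q (x ⊕ y) - Q x - Q y

  -- Free of coordinates, so that a restriction to a complement or a pullback is again a form
  -- without computing a matrix for it.
  record IsQuadratic (Q : V m → Carrier) : Set (c ⊔ ℓ₁) where
    field
      Q-cong           : ∀ {x y} → x ≋ y → Q x ≈ Q y
      Q-scale          : ∀ a x → Q (a ⊙ x) ≈ a * a * Q x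
      polar-functional : ∀ x → IsFunctional (polarization Q x)

    Q-⊕ : ∀ x y → Q (x ⊕ y) ≈ Q x + Q y + polarization Q x y
    Q-⊕ x y = solve 3 (λ s a b → s := a :+ b :+ (s :- a :- b)) refl (Q (x ⊕ y)) (Q x) (Q y)

    polar-sym : ∀ x y → polarization Q x y ≈ polarization Q y x
    polar-sym x y = trans (+-congʳ (+-congʳ (Q-cong λ i → +-comm (x i) (y i))))
      (solve 3 (λ s a b → s :- a :- b := s :- b :- a) refl (Q (y ⊕ x)) (Q x) (Q y))

    polar-functionalˡ : ∀ y → IsFunctional λ x → polarization Q x y
    polar-functionalˡ y = functional-resp (polar-sym y) (polar-functional y)

    Q-null : Q 0ⱽ ≈ 0#
    Q-null = begin
      Q 0ⱽ             ≈⟨ Q-cong (λ _ → sym (zeroˡ 0#)) ⟩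
      Q (0# ⊙ 0ⱽ)      ≈⟨ Q-scale 0# 0ⱽ ⟩
      0# * 0# * Q 0ⱽ   ≈⟨ trans (*-congʳ (zeroˡ 0#)) (zeroˡ _) ⟩
      0#               ∎

    singular-scale : ∀ a {x} → Q x ≈ 0# → Q (a ⊙ x) ≈ 0#
    singular-scale a {x} Qx≈0 = trans (Q-scale a x) (trans (*-congˡ Qx≈0) (zeroʳ _))

    singular-polar-self : ∀ {x} → Q x ≈ 0# → polarization Q x x ≈ 0#
    singular-polar-self {x} Qx≈0 = begin
      Q (x ⊕ x) - Q x - Q x   ≈⟨ +-cong (+-cong doubled (-‿cong Qx≈0)) (-‿cong Qx≈0) ⟩
      0# - 0# - 0#            ≈⟨ solve 0 (con (+ 0) :- con (+ 0) :- con (+ 0) := con (+ 0)) refl ⟩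
      0#                      ∎
      where
      doubled : Q (x ⊕ x) ≈ 0#
      doubled = trans (Q-cong λ i → sym (trans (distribʳ (x i) 1# 1#) (+-cong (*-identityˡ _) (*-identityˡ _))))
        (singular-scale (1# + 1#) Qx≈0)

  open IsQuadratic

  polar-null : {Q : V m → Carrier} → IsQuadratic Q → ∀ x y → x ≋ 0ⱽ → polarization Q x y ≈ 0#
  polar-null isQ x y x≋0 = trans (polar-functionalˡ isQ y .cong x≋0) (null (polar-functionalˡ isQ y))

  polar-zero : {Q : V m → Carrier} → IsQuadratic Q → ∀ x y →
               Q x ≈ 0# → Q y ≈ 0# → Q (x ⊕ y) ≈ 0# → polarization Q x y ≈ 0#
  polar-zero isQ x y Qx≈0 Qy≈0 Qx+y≈0 = trans (+-cong (+-cong Qx+y≈0 (-‿cong Qx≈0)) (-‿cong Qy≈0))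
    (solve 0 (con (+ 0) :- con (+ 0) :- con (+ 0) := con (+ 0)) refl)

  quadratic-zero : IsQuadratic {m} λ _ → 0#
  quadratic-zero .Q-cong _           = refl
  quadratic-zero .Q-scale _ _        = sym (zeroʳ _)
  quadratic-zero .polar-functional _ = functional-resp
    (λ _ → solve 0 (con (+ 0) := con (+ 0) :- con (+ 0) :- con (+ 0)) refl) zero-functional

  quadratic-+ : {Q R : V m → Carrier} → IsQuadratic Q → IsQuadratic R → IsQuadratic λ x → Q x + R x
  quadratic-+ isQ isR .Q-cong x≋y = +-cong (isQ .Q-cong x≋y) (isR .Q-cong x≋y)
  quadratic-+ isQ isR .Q-scale a x = trans (+-cong (isQ .Q-scale a x) (isR .Q-scale a x)) (sym (distribˡ _ _ _))
  quadratic-+ {Q = Q} {R} isQ isR .polar-functional x = functional-resp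
    (λ y → solve 6 (λ s t a b a′ b′ → s :- a :- b :+ (t :- a′ :- b′) := s :+ t :- (a :+ a′) :- (b :+ b′))
             refl (Q (x ⊕ y)) (R (x ⊕ y)) (Q x) (Q y) (R x) (R y))
    (+-functional (isQ .polar-functional x) (isR .polar-functional x))

  quadratic-scale : ∀ b {Q : V m → Carrier} → IsQuadratic Q → IsQuadratic λ x → b * Q x
  quadratic-scale b isQ .Q-cong x≋y = *-congˡ (isQ .Q-cong x≋y)
  quadratic-scale b {Q} isQ .Q-scale a x = trans (*-congˡ (isQ .Q-scale a x))
    (solve 3 (λ a b s → b :* (a :* a :* s) := a :* a :* (b :* s)) refl a b (Q x))
  quadratic-scale b {Q} isQ .polar-functional x = functional-resp
    (λ y → solve 4 (λ b s u v → b :* (s :- u :- v) := b :* s :- b :* u :- b :* v) refl b (Q (x ⊕ y)) (Q x) (Q y))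
    (*-functional b (isQ .polar-functional x))

  quadratic-sum : (Q : Fin k → V m → Carrier) → (∀ i → IsQuadratic (Q i)) → IsQuadratic λ x → sum λ i → Q i x
  quadratic-sum {zero}  Q isQ = quadratic-zero
  quadratic-sum {suc _} Q isQ = quadratic-+ (isQ zero) (quadratic-sum (Q ∘ suc) (isQ ∘ suc))

  quadratic-* : {g h : V m → Carrier} → IsFunctional g → IsFunctional h → IsQuadratic λ x → g x * h x
  quadratic-* G H .Q-cong x≋y = *-cong (G .cong x≋y) (H .cong x≋y)
  quadratic-* {g = g} {h} G H .Q-scale a x = trans (*-cong (G .scale a x) (H .scale a x))
    (solve 3 (λ a g h → a :* g :* (a :* h) := a :* a :* (g :* h)) refl a (g x) (h x))
  quadratic-* {g = g} {h} G H .polar-functional x = functional-resp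
    (λ y → sym (trans (+-congʳ (+-congʳ (*-cong (G .add x y) (H .add x y))))
      (solve 4 (λ g g′ h h′ → (g :+ g′) :* (h :+ h′) :- g :* h :- g′ :* h′ := g :* h′ :+ h :* g′)
         refl (g x) (g y) (h x) (h y))))
    (+-functional (*-functional (g x) H) (*-functional (h x) G))

  polarization-∘ : {Q : V n → Carrier} → IsQuadratic Q → {M : V m → V n} → IsLinear M → ∀ x y →
                   polarization Q (M x) (M y) ≈ polarization (Q ∘ M) x y
  polarization-∘ isQ L x y = +-congʳ (+-congʳ (isQ .Q-cong λ i → sym (L i .add x y)))

  quadratic-∘ : {Q : V n → Carrier} → IsQuadratic Q → {M : V m → V n} → IsLinear M → IsQuadratic (Q ∘ M)
  quadratic-∘ isQ L .Q-cong x≋y  = isQ .Q-cong λ i → L i .cong x≋y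
  quadratic-∘ isQ L .Q-scale a x = trans (isQ .Q-cong λ i → L i .scale a x) (isQ .Q-scale a _)
  quadratic-∘ isQ L .polar-functional x = functional-resp (polarization-∘ isQ L x)
    (functional-∘ (isQ .polar-functional _) L)

  Nondegenerate : (V m → Carrier) → Set (c ⊔ ℓ₁)
  Nondegenerate Q = ∀ {x} → Q x ≈ 0# → (∀ y → polarization Q x y ≈ 0#) → x ≋ 0ⱽ

  record TotallySingular (k : ℕ) (Q : V m → Carrier) : Set (c ⊔ ℓ₁) where
    field
      embed     : V k → V m
      linear    : IsLinear embed
      injective : Injective₀ embed
      singular  : ∀ x → Q (embed x) ≈ 0#

  -- In odd characteristic two forms of rank 1 can differ by a nonsquare, hence the factor.
  -- Injectivity of `map` is recovered from non-degeneracy in `similar-injective`.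
  record Similar (Q : V m → Carrier) (Q′ : V n → Carrier) : Set (c ⊔ ℓ₁) where
    field
      factor     : Carrier
      factor≉0   : factor ≉0
      map        : V m → V n
      linear     : IsLinear map
      similitude : ∀ x → Q x ≈ factor * Q′ (map x)

  -- An orthogonal sum of the hyperbolic plane on `p`, `p′` and the image of `ι`. The coefficient at
  -- `p` is a product with `p′` and conversely, because `p` and `p′` are singular with product 1.
  record HyperbolicSplitting (Q : V (suc (suc m)) → Carrier) (p : V (suc (suc m))) : Set (c ⊔ ℓ₁) where
    field
      p′          : V (suc (suc m))
      Qp≈0        : Q p ≈ 0#
      Qp′≈0       : Q p′ ≈ 0#
      pp′≈1       : polarization Q p p′ ≈ 1#
      ι           : V m → V (suc (suc m))
      ρ           : V (suc (suc m)) → V m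
      ι-linear    : IsLinear ι
      ρ-linear    : IsLinear ρ
      ι-injective : Injective₀ ι
      p⊥ι         : ∀ y → polarization Q p (ι y) ≈ 0#
      p′⊥ι        : ∀ y → polarization Q p′ (ι y) ≈ 0#
      decompose   : ∀ x → x ≋ polarization Q p′ x ⊙ p ⊕ polarization Q p x ⊙ p′ ⊕ ι (ρ x)

  module _ {Q : V (suc (suc m)) → Carrier} (isQ : IsQuadratic Q) (nonDeg : Nondegenerate Q) where

    partner : ∀ p → ¬ p ≋ 0ⱽ → Q p ≈ 0# → ∃[ p′ ] Q p′ ≈ 0# × polarization Q p p′ ≈ 1#
    partner p p≉0 Qp≈0 = [ (λ p⊥ → contradiction (nonDeg Qp≈0 p⊥) p≉0) , normalise ]′
        (zero-or-not (isQ .polar-functional p))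
      where
      B = polarization Q
      normalise : ∃[ y ] B p y ≉0 → ∃[ p′ ] Q p′ ≈ 0# × B p p′ ≈ 1#
      -- With `z` scaled so that `B p z ≈ 1#`, one has `Q (z + a p) = Q z + a`, whence the choice
      -- `a = - Q z`; adding a multiple of `p` leaves the product with `p` unchanged.
      normalise (y , py≉0) = z ⊕ (- Q z) ⊙ p , Q≈0 , (begin
          B p (z ⊕ (- Q z) ⊙ p)         ≈⟨ isQ .polar-functional p .add z _ ⟩
          B p z + B p ((- Q z) ⊙ p)     ≈⟨ +-cong pz≈1 (isQ .polar-functional p .scale _ p) ⟩
          1# + - Q z * B p p            ≈⟨ +-congˡ (trans (*-congˡ (singular-polar-self isQ Qp≈0)) (zeroʳ _)) ⟩
          1# + 0#                       ≈⟨ +-identityʳ 1# ⟩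
          1#                            ∎)
        where
        d = inverse py≉0 .proj₁
        z = d ⊙ y
        pz≈1 : B p z ≈ 1#
        pz≈1 = trans (isQ .polar-functional p .scale d y) (trans (*-comm d _) (inverse py≉0 .proj₂))
        Q≈0 : Q (z ⊕ (- Q z) ⊙ p) ≈ 0#
        Q≈0 = begin
          Q (z ⊕ (- Q z) ⊙ p)                            ≈⟨ Q-⊕ isQ z _ ⟩
          Q z + Q ((- Q z) ⊙ p) + B z ((- Q z) ⊙ p)      ≈⟨ +-cong (+-congˡ (singular-scale isQ (- Q z) Qp≈0))
                                                              (trans (isQ .polar-functional z .scale _ p) (*-congˡ (trans (polar-sym isQ z p) pz≈1))) ⟩
          Q z + 0# + - Q z * 1#                          ≈⟨ +-cong (+-identityʳ _) (*-identityʳ _) ⟩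
          Q z - Q z                                      ≈⟨ -‿inverseʳ _ ⟩
          0#                                             ∎

    module _ {p p′} (Qp≈0 : Q p ≈ 0#) (Qp′≈0 : Q p′ ≈ 0#) (pp′≈1 : polarization Q p p′ ≈ 1#)
             (K₁ : KernelCoordinates (polarization Q p))
             (K₂ : KernelCoordinates (polarization Q p′ ∘ KernelCoordinates.ι K₁)) where
      private
        module K₁ = KernelCoordinates K₁
        module K₂ = KernelCoordinates K₂
        B = polarization Q

      p′p≈1 : B p′ p ≈ 1#
      p′p≈1 = trans (polar-sym isQ p′ p) pp′≈1

      -- The orthogonal projection onto the complement of the plane spanned by `p` and `p′`.
      π : V (suc (suc m)) → V (suc (suc m))
      π x = x ⊕ ((- 1# * B p′ x) ⊙ p ⊕ (- 1# * B p x) ⊙ p′)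

      π-linear : IsLinear π
      π-linear = ⊕-linear coordinate (⊕-linear
        (⊙-linear (*-functional (- 1#) (isQ .polar-functional p′)) p)
        (⊙-linear (*-functional (- 1#) (isQ .polar-functional p)) p′))

      π≈ : ∀ x i → π x i ≈ x i - (B p′ x * p i + B p x * p′ i)
      π≈ x i = +-congˡ (trans (+-cong (*-congʳ (-1*x≈-x _)) (*-congʳ (-1*x≈-x _)))
        (solve 4 (λ a b u v → (:- a) :* u :+ (:- b) :* v := :- (a :* u :+ b :* v)) refl (B p′ x) (B p x) (p i) (p′ i)))

      polar-π : ∀ z x → B z (π x) ≈ B z x - (B p′ x * B z p + B p x * B z p′)
      polar-π z x = begin
        B z (π x)
          ≈⟨ B-z .add x _ ⟩
        B z x + B z ((- 1# * B p′ x) ⊙ p ⊕ (- 1# * B p x) ⊙ p′)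
          ≈⟨ +-congˡ (trans (B-z .add _ _) (+-cong (B-z .scale _ p) (B-z .scale _ p′))) ⟩
        B z x + (- 1# * B p′ x * B z p + - 1# * B p x * B z p′)
          ≈⟨ +-congˡ (+-cong (*-congʳ (-1*x≈-x _)) (*-congʳ (-1*x≈-x _))) ⟩
        B z x + (- B p′ x * B z p + - B p x * B z p′)
          ≈⟨ solve 5 (λ s a b u v → s :+ ((:- a) :* u :+ (:- b) :* v) := s :- (a :* u :+ b :* v))
               refl (B z x) (B p′ x) (B p x) (B z p) (B z p′) ⟩
        B z x - (B p′ x * B z p + B p x * B z p′) ∎
        where B-z = isQ .polar-functional z

      cancel-left : ∀ {s a b u v} → u ≈ 0# → v ≈ 1# → s ≈ b → s - (a * u + b * v) ≈ 0#
      cancel-left {s} {a} {b} {u} {v} u≈0 v≈1 s≈b = begin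
        s - (a * u + b * v)
          ≈⟨ +-cong s≈b (-‿cong (+-cong (trans (*-congˡ u≈0) (zeroʳ a)) (trans (*-congˡ v≈1) (*-identityʳ b)))) ⟩
        b - (0# + b)           ≈⟨ trans (+-congˡ (-‿cong (+-identityˡ b))) (-‿inverseʳ b) ⟩
        0#                     ∎

      p⊥π : ∀ x → B p (π x) ≈ 0#
      p⊥π x = trans (polar-π p x) (cancel-left (singular-polar-self isQ Qp≈0) pp′≈1 refl)

      p′⊥π : ∀ x → B p′ (π x) ≈ 0#
      p′⊥π x = trans (polar-π p′ x) (trans (+-congˡ (-‿cong (+-comm _ _)))
        (cancel-left (singular-polar-self isQ Qp′≈0) p′p≈1 refl))

      -- The maps `ρ` invert `ι` on the kernels only. `K₁` describes the vectors orthogonal to `p`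
      -- and `K₂` those among them orthogonal to `p′`; `π x` is orthogonal to both.
      ιρ : ∀ x → K₁.ι (K₂.ι (K₂.ρ (K₁.ρ (π x)))) ≋ π x
      ιρ x i = trans
        (K₁.ι-linear i .cong (K₂.ι∘ρ (trans (isQ .polar-functional p′ .cong (K₁.ι∘ρ (p⊥π x))) (p′⊥π x))))
        (K₁.ι∘ρ (p⊥π x) i)

      split-along : HyperbolicSplitting Q p
      split-along = record
        { p′          = p′
        ; Qp≈0        = Qp≈0
        ; Qp′≈0       = Qp′≈0
        ; pp′≈1       = pp′≈1
        ; ι           = K₁.ι ∘ K₂.ι
        ; ρ           = K₂.ρ ∘ K₁.ρ ∘ π
        ; ι-linear    = linear-∘ K₁.ι-linear K₂.ι-linear
        ; ρ-linear    = linear-∘ K₂.ρ-linear (linear-∘ K₁.ρ-linear π-linear)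
        ; ι-injective = K₂.ι-injective ∘ K₁.ι-injective
        ; p⊥ι         = K₁.g∘ι ∘ K₂.ι
        ; p′⊥ι        = K₂.g∘ι
        ; decompose   = λ x i → begin
            x i
              ≈⟨ solve 3 (λ x a b → x := a :+ b :+ (x :- (a :+ b))) refl (x i) (B p′ x * p i) (B p x * p′ i) ⟩
            B p′ x * p i + B p x * p′ i + (x i - (B p′ x * p i + B p x * p′ i))
              ≈⟨ +-congˡ (π≈ x i) ⟨
            B p′ x * p i + B p x * p′ i + π x i
              ≈⟨ +-congˡ (ιρ x i) ⟨
            B p′ x * p i + B p x * p′ i + K₁.ι (K₂.ι (K₂.ρ (K₁.ρ (π x)))) i ∎
        }

    split : ∀ p → ¬ p ≋ 0ⱽ → Q p ≈ 0# → HyperbolicSplitting Q p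
    split p p≉0 Qp≈0 = let p′ , Qp′≈0 , pp′≈1 = partner p p≉0 Qp≈0 in with-partner p′ Qp′≈0 pp′≈1
      where
      B = polarization Q

      nonzero : ∀ {a} → a ≈ 1# → a ≉0
      nonzero a≈1 a≈0 = 1≉0 (trans (sym a≈1) a≈0)

      with-partner : ∀ p′ → Q p′ ≈ 0# → B p p′ ≈ 1# → HyperbolicSplitting Q p
      -- `kernel` needs vectors at which its functionals do not vanish: `p′` for `B p`, and `p`,
      -- which is orthogonal to itself, for `B p′` restricted to the kernel of `B p`.
      with-partner p′ Qp′≈0 pp′≈1 = split-along Qp≈0 Qp′≈0 pp′≈1 K₁
        (kernel m (functional-∘ (isQ .polar-functional p′) K₁.ι-linear) (K₁.ρ p) (nonzero (begin
          B p′ (K₁.ι (K₁.ρ p))   ≈⟨ isQ .polar-functional p′ .cong (K₁.ι∘ρ (singular-polar-self isQ Qp≈0)) ⟩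
          B p′ p                 ≈⟨ polar-sym isQ p′ p ⟩
          B p p′                 ≈⟨ pp′≈1 ⟩
          1#                     ∎)))
        where
        K₁ = kernel (suc m) (isQ .polar-functional p) p′ (nonzero pp′≈1)
        module K₁ = KernelCoordinates K₁

  module _ {Q : V (suc (suc m)) → Carrier} (isQ : IsQuadratic Q) {p} (S : HyperbolicSplitting Q p) where
    open HyperbolicSplitting S
    private
      B = polarization Q

    combine : ∀ a b y → Q (a ⊙ p ⊕ b ⊙ p′ ⊕ ι y) ≈ a * b + Q (ι y)
    combine a b y = begin
      Q (a ⊙ p ⊕ b ⊙ p′ ⊕ ι y)
        ≈⟨ Q-⊕ isQ _ _ ⟩
      Q (a ⊙ p ⊕ b ⊙ p′) + Q (ι y) + B (a ⊙ p ⊕ b ⊙ p′) (ι y)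
        ≈⟨ +-cong (+-congʳ plane) orthogonal ⟩
      a * b + Q (ι y) + 0#
        ≈⟨ +-identityʳ _ ⟩
      a * b + Q (ι y) ∎
      where
      plane : Q (a ⊙ p ⊕ b ⊙ p′) ≈ a * b
      plane = begin
        Q (a ⊙ p ⊕ b ⊙ p′)
          ≈⟨ Q-⊕ isQ _ _ ⟩
        Q (a ⊙ p) + Q (b ⊙ p′) + B (a ⊙ p) (b ⊙ p′)
          ≈⟨ +-cong (+-cong (singular-scale isQ a Qp≈0) (singular-scale isQ b Qp′≈0))
               (trans (isQ .polar-functional _ .scale b p′) (*-congˡ (polar-functionalˡ isQ p′ .scale a p))) ⟩
        0# + 0# + b * (a * B p p′)
          ≈⟨ +-congˡ (*-congˡ (*-congˡ pp′≈1)) ⟩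
        0# + 0# + b * (a * 1#)
          ≈⟨ trans (+-cong (+-identityˡ 0#) (*-congˡ (*-identityʳ a))) (trans (+-identityˡ _) (*-comm b a)) ⟩
        a * b ∎
      orthogonal : B (a ⊙ p ⊕ b ⊙ p′) (ι y) ≈ 0#
      orthogonal = begin
        B (a ⊙ p ⊕ b ⊙ p′) (ι y)           ≈⟨ polar-functionalˡ isQ (ι y) .add _ _ ⟩
        B (a ⊙ p) (ι y) + B (b ⊙ p′) (ι y)
          ≈⟨ +-cong (polar-functionalˡ isQ (ι y) .scale a p) (polar-functionalˡ isQ (ι y) .scale b p′) ⟩
        a * B p (ι y) + b * B p′ (ι y)
          ≈⟨ +-cong (trans (*-congˡ (p⊥ι y)) (zeroʳ a)) (trans (*-congˡ (p′⊥ι y)) (zeroʳ b)) ⟩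
        0# + 0#                            ≈⟨ +-identityˡ 0# ⟩
        0#                                 ∎

    Q-split : ∀ x → Q x ≈ B p′ x * B p x + Q (ι (ρ x))
    Q-split x = trans (isQ .Q-cong (decompose x)) (combine _ _ _)

    complement-quadratic : IsQuadratic (Q ∘ ι)
    complement-quadratic = quadratic-∘ isQ ι-linear

    -- The complement is orthogonal to the plane, so a vector of its radical is orthogonal to the
    -- whole space.
    complement-nondegenerate : Nondegenerate Q → Nondegenerate (Q ∘ ι)
    complement-nondegenerate nonDeg {y} Qy≈0 y⊥ = ι-injective (nonDeg Qy≈0 λ x → begin
      B (ι y) x
        ≈⟨ isQ .polar-functional (ι y) .cong (decompose x) ⟩
      B (ι y) (B p′ x ⊙ p ⊕ B p x ⊙ p′ ⊕ ι (ρ x))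
        ≈⟨ trans (isQ .polar-functional (ι y) .add _ _) (+-cong (isQ .polar-functional (ι y) .add _ _) (polarization-∘ isQ ι-linear y (ρ x))) ⟩
      B (ι y) (B p′ x ⊙ p) + B (ι y) (B p x ⊙ p′) + polarization (Q ∘ ι) y (ρ x)
        ≈⟨ +-cong (+-cong (vanish (B p′ x) (p⊥ι y)) (vanish (B p x) (p′⊥ι y))) (y⊥ (ρ x)) ⟩
      0# + 0# + 0#
        ≈⟨ trans (+-identityʳ _) (+-identityʳ _) ⟩
      0# ∎)
      where
      vanish : ∀ a {z} → B z (ι y) ≈ 0# → B (ι y) (a ⊙ z) ≈ 0#
      vanish a {z} z⊥ = trans (isQ .polar-functional (ι y) .scale a z)
        (trans (*-congˡ (trans (polar-sym isQ (ι y) z) z⊥)) (zeroʳ a))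

    -- Adjoining `p` to a totally singular subspace of the complement raises its rank by one: `p` is
    -- not in the complement because its product with `p′` is 1.
    complement-maximal : ¬ TotallySingular (suc n) Q → ¬ TotallySingular n (Q ∘ ι)
    complement-maximal maximal T = maximal (record
      { embed     = λ x → head x ⊙ p ⊕ ι (T.embed (tail x))
      ; linear    = extend-linear (linear-∘ ι-linear T.linear) p
      ; injective = λ {x} eq → extend-injective (linear-∘ ι-linear T.linear) (T.injective ∘ ι-injective) p
          (λ (y , ιy≋p) → 1≉0 (begin
            1#                         ≈⟨ pp′≈1 ⟨
            B p p′                     ≈⟨ polar-sym isQ p p′ ⟩
            B p′ p                     ≈⟨ isQ .polar-functional p′ .cong (≋-sym ιy≋p) ⟩
            B p′ (ι (T.embed y))       ≈⟨ p′⊥ι _ ⟩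
            0#                         ∎)) {x} eq
      ; singular  = λ x → begin
          Q (head x ⊙ p ⊕ ι (T.embed (tail x)))
            ≈⟨ isQ .Q-cong (λ i → +-congʳ (sym (trans (+-congˡ (zeroˡ _)) (+-identityʳ _)))) ⟩
          Q (head x ⊙ p ⊕ 0# ⊙ p′ ⊕ ι (T.embed (tail x)))
            ≈⟨ combine _ _ _ ⟩
          head x * 0# + Q (ι (T.embed (tail x)))
            ≈⟨ +-cong (zeroʳ _) (T.singular (tail x)) ⟩
          0# + 0#
            ≈⟨ +-identityˡ 0# ⟩
          0# ∎
      })
      where module T = TotallySingular T

  first : {Q : V m → Carrier} → TotallySingular (suc n) Q → V m
  first T = TotallySingular.embed T e₀

  first≉0 : {Q : V m → Carrier} (T : TotallySingular (suc n) Q) → ¬ first T ≋ 0ⱽ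
  first≉0 T eq = 1≉0 (TotallySingular.injective T eq zero)

  -- A totally singular subspace is orthogonal to its vector `p`, so its vectors have no component
  -- along `p′`. Hence `ι ∘ ρ` changes them only by a multiple of `p`, and they remain singular.
  complement-singular : {Q : V (suc (suc m)) → Carrier} → IsQuadratic Q → (T : TotallySingular (suc n) Q) →
                        (S : HyperbolicSplitting Q (first T)) →
                        TotallySingular n (Q ∘ HyperbolicSplitting.ι S)
  complement-singular {Q = Q} isQ T S = record
    { embed     = ρ ∘ M
    ; linear    = linear-∘ ρ-linear M-linear
    ; injective = λ {y} eq i → trans
        -- If `ρ (M y)` vanishes, `M y` is a multiple of `p`, the image of `e₀`; so `0# ∷ y` is a
        -- multiple of `e₀` and its tail is zero.
        (injective-≋ T.linear T.injective {0# ∷ y} {B p′ (M y) ⊙ e₀} (λ j → begin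
          M y j
            ≈⟨ decompose (M y) j ⟩
          B p′ (M y) * p j + B p (M y) * p′ j + ι (ρ (M y)) j
            ≈⟨ +-cong (+-congˡ (trans (*-congʳ (p⊥M y)) (zeroˡ _))) (trans (ι-linear j .cong eq) (null (ι-linear j))) ⟩
          B p′ (M y) * p j + 0# + 0#
            ≈⟨ trans (+-identityʳ _) (+-identityʳ _) ⟩
          B p′ (M y) * p j
            ≈⟨ T.linear j .scale _ e₀ ⟨
          T.embed (B p′ (M y) ⊙ e₀) j ∎) (suc i))
        (zeroʳ _)
    ; singular  = λ y → begin
        Q (ι (ρ (M y)))                             ≈⟨ +-identityˡ _ ⟨
        0# + Q (ι (ρ (M y)))                        ≈⟨ +-congʳ (trans (*-congˡ (p⊥M y)) (zeroʳ _)) ⟨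
        B p′ (M y) * B p (M y) + Q (ι (ρ (M y)))    ≈⟨ Q-split isQ S (M y) ⟨
        Q (M y)                                     ≈⟨ T.singular _ ⟩
        0#                                          ∎
    }
    where
    open HyperbolicSplitting S
    module T = TotallySingular T
    B = polarization Q
    p = first T

    M = T.embed ∘ (0# ∷_)

    M-linear : IsLinear M
    M-linear = linear-∘ T.linear 0∷-linear

    p⊥M : ∀ y → B p (M y) ≈ 0#
    p⊥M y = polar-zero isQ p (M y) (T.singular e₀) (T.singular (0# ∷ y)) (trans
      (isQ .Q-cong λ i → sym (T.linear i .add e₀ (0# ∷ y))) (T.singular _))

  -- The plane has to be mapped with the factor already fixed on the complement. This is arranged by
  -- scaling one vector of the hyperbolic pair by `μ`, the inverse of the factor.
  similar-extend : {Q : V (suc (suc m)) → Carrier} {Q′ : V (suc (suc n)) → Carrier} →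
                   IsQuadratic Q → IsQuadratic Q′ → ∀ {p r} →
                   (S : HyperbolicSplitting Q p) (S′ : HyperbolicSplitting Q′ r) →
                   Similar (Q ∘ HyperbolicSplitting.ι S) (Q′ ∘ HyperbolicSplitting.ι S′) → Similar Q Q′
  similar-extend {Q = Q} {Q′} isQ isQ′ {p} {r} S S′ sim = record
    { factor     = factor
    ; factor≉0   = factor≉0
    ; map        = λ x → (μ * B S.p′ x) ⊙ r ⊕ B p x ⊙ S′.p′ ⊕ S′.ι (map (S.ρ x))
    ; linear     = ⊕-linear
        (⊕-linear (⊙-linear (*-functional μ (isQ .polar-functional S.p′)) r) (⊙-linear (isQ .polar-functional p) S′.p′))
        (linear-∘ S′.ι-linear (linear-∘ linear S.ρ-linear))
    ; similitude = λ x → begin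
        Q x
          ≈⟨ Q-split isQ S x ⟩
        B S.p′ x * B p x + Q (S.ι (S.ρ x))
          ≈⟨ +-cong (trans (sym (*-identityˡ _)) (*-congʳ (sym factor*μ≈1))) (similitude (S.ρ x)) ⟩
        factor * μ * (B S.p′ x * B p x) + factor * Q′ (S′.ι (map (S.ρ x)))
          ≈⟨ solve 5 (λ f m a b w → f :* m :* (a :* b) :+ f :* w := f :* (m :* a :* b :+ w)) refl
               factor μ (B S.p′ x) (B p x) (Q′ (S′.ι (map (S.ρ x)))) ⟩
        factor * (μ * B S.p′ x * B p x + Q′ (S′.ι (map (S.ρ x))))
          ≈⟨ *-congˡ (combine isQ′ S′ _ _ _) ⟨
        factor * Q′ ((μ * B S.p′ x) ⊙ r ⊕ B p x ⊙ S′.p′ ⊕ S′.ι (map (S.ρ x))) ∎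
    }
    where
    module S = HyperbolicSplitting S
    module S′ = HyperbolicSplitting S′
    open Similar sim
    B = polarization Q
    μ = inverse factor≉0 .proj₁
    factor*μ≈1 = inverse factor≉0 .proj₂

  -- Anisotropic forms of rank at most two, and the classification up to similarity.

  anisotropic : {Q : V m → Carrier} → IsQuadratic Q → ¬ TotallySingular 1 Q → ∀ {x} → Q x ≈ 0# → x ≋ 0ⱽ
  anisotropic isQ maximal {x} Qx≈0 with x ≋? 0ⱽ
  ... | yes x≋0 = x≋0
  ... | no x≉0  = contradiction (record
    { embed     = λ y → head y ⊙ x
    ; linear    = ⊙-linear (coordinate zero) x
    ; injective = λ {y} eq → λ where
        zero     → decidable-stable (head y ≟ 0#) λ h≉0 → x≉0 λ i → integral h≉0 (eq i)
        (suc ())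
    ; singular  = λ y → singular-scale isQ (head y) Qx≈0
    }) maximal

  similar-rank-0 : {Q Q′ : V 0 → Carrier} → IsQuadratic Q → IsQuadratic Q′ → Similar Q Q′
  similar-rank-0 isQ isQ′ = record
    { factor     = 1#
    ; factor≉0   = 1≉0
    ; map        = id
    ; linear     = coordinate
    ; similitude = λ x → trans (trans (isQ .Q-cong (λ ())) (Q-null isQ))
        (sym (trans (*-identityˡ _) (trans (isQ′ .Q-cong (λ ())) (Q-null isQ′))))
    }

  similar-rank-1 : {Q Q′ : V 1 → Carrier} → IsQuadratic Q → IsQuadratic Q′ →
                   (∀ {x} → Q x ≈ 0# → x ≋ 0ⱽ) → (∀ {x} → Q′ x ≈ 0# → x ≋ 0ⱽ) → Similar Q Q′
  similar-rank-1 {Q} {Q′} isQ isQ′ anis anis′ = record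
    { factor     = Q e₀ * b
    ; factor≉0   = λ eq → 1≉0 (trans (sym (inverse a′≉0 .proj₂)) (trans (*-congˡ (integral a≉0 eq)) (zeroʳ _)))
    ; map        = id
    ; linear     = coordinate
    ; similitude = λ x → begin
        Q x                                    ≈⟨ diagonal isQ x ⟩
        head x * head x * Q e₀                 ≈⟨ *-identityʳ _ ⟨
        head x * head x * Q e₀ * 1#            ≈⟨ *-congˡ (inverse a′≉0 .proj₂) ⟨
        head x * head x * Q e₀ * (Q′ e₀ * b)
          ≈⟨ solve 4 (λ h a b a′ → h :* h :* a :* (a′ :* b) := a :* b :* (h :* h :* a′))
               refl (head x) (Q e₀) b (Q′ e₀) ⟩
        Q e₀ * b * (head x * head x * Q′ e₀)   ≈⟨ *-congˡ (diagonal isQ′ x) ⟨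
        Q e₀ * b * Q′ x                        ∎
    }
    where
    a≉0 : Q e₀ ≉0
    a≉0 eq = 1≉0 (anis eq zero)
    a′≉0 : Q′ e₀ ≉0
    a′≉0 eq = 1≉0 (anis′ eq zero)
    b = inverse a′≉0 .proj₁
    diagonal : {R : V 1 → Carrier} → IsQuadratic R → ∀ x → R x ≈ head x * head x * R e₀
    diagonal isR x = trans (isR .Q-cong λ where zero → sym (*-identityʳ _)) (isR .Q-scale (head x) e₀)

  record MonicCoordinates (Q : V 2 → Carrier) : Set (c ⊔ ℓ₁) where
    field
      lead β γ : Carrier
      lead≉0   : lead ≉0
      expand   : ∀ x → let s = head x; t = head (tail x) in Q x ≈ lead * (s * s + β * (s * t) + γ * (t * t))
      no-root  : NoRoot β γ

  monic-coordinates : {Q : V 2 → Carrier} → IsQuadratic Q → (∀ {x} → Q x ≈ 0# → x ≋ 0ⱽ) → MonicCoordinates Q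
  monic-coordinates {Q} isQ anis = record
    { lead    = a
    ; β       = i * b
    ; γ       = i * d
    ; lead≉0  = a≉0
    ; expand  = expand
    -- A root `t` would make the vector (t, 1) singular.
    ; no-root = λ t root → 1≉0 (anis {t ∷ 1# ∷ []} (trans (expand (t ∷ 1# ∷ [])) (trans (*-congˡ (begin
        t * t + i * b * (t * 1#) + i * d * (1# * 1#)
          ≈⟨ +-cong (+-congˡ (*-congˡ (*-identityʳ t))) (trans (*-congˡ (*-identityʳ 1#)) (*-identityʳ _)) ⟩
        t * t + i * b * t + i * d                    ≈⟨ root ⟩
        0#                                           ∎)) (zeroʳ a))) (suc zero))
    }
    where
    B = polarization Q
    e₁ : V 2
    e₁ = 0# ∷ e₀
    a = Q e₀
    b = B e₀ e₁
    d = Q e₁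
    a≉0 : a ≉0
    a≉0 eq = 1≉0 (anis eq zero)
    i = inverse a≉0 .proj₁
    ai≈1 = inverse a≉0 .proj₂
    expand : ∀ x → Q x ≈ a * (head x * head x + i * b * (head x * head (tail x)) + i * d * (head (tail x) * head (tail x)))
    expand x = begin
      Q x
        ≈⟨ isQ .Q-cong (λ where
             zero       → sym (trans (+-cong (*-identityʳ s) (zeroʳ t)) (+-identityʳ s))
             (suc zero) → sym (trans (+-cong (zeroʳ s) (*-identityʳ t)) (+-identityˡ t))) ⟩
      Q (s ⊙ e₀ ⊕ t ⊙ e₁)
        ≈⟨ Q-⊕ isQ _ _ ⟩
      Q (s ⊙ e₀) + Q (t ⊙ e₁) + B (s ⊙ e₀) (t ⊙ e₁)
        ≈⟨ +-cong (+-cong (isQ .Q-scale s e₀) (isQ .Q-scale t e₁))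
             (trans (isQ .polar-functional _ .scale t e₁) (*-congˡ (polar-functionalˡ isQ e₁ .scale s e₀))) ⟩
      s * s * a + t * t * d + t * (s * b)
        ≈⟨ +-cong (+-congˡ (sym (trans (*-congʳ ai≈1) (*-identityˡ _)))) (sym (trans (*-congʳ ai≈1) (*-identityˡ _))) ⟩
      s * s * a + a * i * (t * t * d) + a * i * (t * (s * b))
        ≈⟨ solve 6 (λ s t a b d i → s :* s :* a :+ a :* i :* (t :* t :* d) :+ a :* i :* (t :* (s :* b))
             := a :* (s :* s :+ i :* b :* (s :* t) :+ i :* d :* (t :* t))) refl s t a b d i ⟩
      a * (s * s + i * b * (s * t) + i * d * (t * t)) ∎
      where
      s = head x
      t = head (tail x)

  module _ {Q Q′ : V 2 → Carrier} (C : MonicCoordinates Q) (C′ : MonicCoordinates Q′) where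
    private
      module C = MonicCoordinates C
      module C′ = MonicCoordinates C′

    substitution : ∀ {v r} → C′.β * r + (v + v) ≈ C.β → v * v + C′.β * (v * r) + C′.γ * (r * r) ≈ C.γ → ∀ s t →
                   s * s + C.β * (s * t) + C.γ * (t * t) ≈
                   (s + t * v) * (s + t * v) + C′.β * ((s + t * v) * (t * r)) + C′.γ * (t * r * (t * r))
    substitution {v} {r} β≈ γ≈ s t = begin
      s * s + C.β * (s * t) + C.γ * (t * t)
        ≈⟨ +-cong (+-congˡ (*-congʳ β≈)) (*-congʳ γ≈) ⟨
      s * s + (C′.β * r + (v + v)) * (s * t) + (v * v + C′.β * (v * r) + C′.γ * (r * r)) * (t * t)
        ≈⟨ solve 6 (λ s t v r b c → s :* s :+ (b :* r :+ (v :+ v)) :* (s :* t) :+ (v :* v :+ b :* (v :* r) :+ c :* (r :* r)) :* (t :* t)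
             := (s :+ t :* v) :* (s :+ t :* v) :+ b :* ((s :+ t :* v) :* (t :* r)) :+ c :* (t :* r :* (t :* r)))
             refl s t v r C′.β C′.γ ⟩
      (s + t * v) * (s + t * v) + C′.β * ((s + t * v) * (t * r)) + C′.γ * (t * r * (t * r)) ∎

    similar-monic : Similar Q Q′
    similar-monic = record
      { factor     = C.lead * i
      ; factor≉0   = λ eq → 1≉0 (trans (sym (inverse C′.lead≉0 .proj₂)) (trans (*-congˡ (integral C.lead≉0 eq)) (zeroʳ _)))
      ; map        = φ
      ; linear     = ∷-linear (+-functional (coordinate zero) (functional-* v (coordinate (suc zero))))
                       (∷-linear (functional-* r (coordinate (suc zero))) (λ ()))
      ; similitude = λ x → begin
          Q x
            ≈⟨ C.expand x ⟩
          C.lead * (head x * head x + C.β * (head x * head (tail x)) + C.γ * (head (tail x) * head (tail x)))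
            ≈⟨ *-congˡ (substitution β≈ γ≈ (head x) (head (tail x))) ⟩
          C.lead * monic x
            ≈⟨ *-congˡ (trans (*-congʳ (inverse C′.lead≉0 .proj₂)) (*-identityˡ _)) ⟨
          C.lead * (C′.lead * i * monic x)
            ≈⟨ solve 4 (λ a a′ i w → a :* (a′ :* i :* w) := a :* i :* (a′ :* w)) refl C.lead C′.lead i (monic x) ⟩
          C.lead * i * (C′.lead * monic x)
            ≈⟨ *-congˡ (C′.expand (φ x)) ⟨
          C.lead * i * Q′ (φ x) ∎
      }
      where
      v = equivalent C.no-root C′.no-root .proj₁
      r = equivalent C.no-root C′.no-root .proj₂ .proj₁
      β≈ = equivalent C.no-root C′.no-root .proj₂ .proj₂ .proj₁
      γ≈ = equivalent C.no-root C′.no-root .proj₂ .proj₂ .proj₂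
      i = inverse C′.lead≉0 .proj₁
      φ : V 2 → V 2
      φ x = (head x + head (tail x) * v) ∷ (head (tail x) * r) ∷ []
      monic : V 2 → Carrier
      monic x = let s = head x; t = head (tail x) in
        (s + t * v) * (s + t * v) + C′.β * ((s + t * v) * (t * r)) + C′.γ * (t * r * (t * r))

  similar-anisotropic : ∀ t {Q Q′ : V (index t) → Carrier} → IsQuadratic Q → IsQuadratic Q′ →
                        (∀ {x} → Q x ≈ 0# → x ≋ 0ⱽ) → (∀ {x} → Q′ x ≈ 0# → x ≋ 0ⱽ) → Similar Q Q′
  similar-anisotropic hyperbolic isQ isQ′ anis anis′ = similar-rank-0 isQ isQ′
  similar-anisotropic parabolic  isQ isQ′ anis anis′ = similar-rank-1 isQ isQ′ anis anis′
  similar-anisotropic elliptic   isQ isQ′ anis anis′ =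
    similar-monic (monic-coordinates isQ anis) (monic-coordinates isQ′ anis′)

  record HasWittIndex (n : ℕ) (Q : V m → Carrier) : Set (c ⊔ ℓ₁) where
    field
      quadratic     : IsQuadratic Q
      nondegenerate : Nondegenerate Q
      attained      : TotallySingular n Q
      maximal       : ¬ TotallySingular (suc n) Q

  -- Each hyperbolic plane takes two from the rank and one from the Witt index, so `n` splittings
  -- leave an anisotropic form of rank `index t`. With the factor 2 on the right, `suc n ℕ.* 2`
  -- computes to two more coordinates.
  similar : ∀ t n {Q Q′ : V (n ℕ.* 2 ℕ.+ index t) → Carrier} → HasWittIndex n Q → HasWittIndex n Q′ → Similar Q Q′
  similar t zero    W W′ = similar-anisotropic t W.quadratic W′.quadratic
    (anisotropic W.quadratic W.maximal) (anisotropic W′.quadratic W′.maximal)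
    where
    module W = HasWittIndex W
    module W′ = HasWittIndex W′
  similar t (suc n) W W′ = similar-extend (HasWittIndex.quadratic W) (HasWittIndex.quadratic W′)
    (splitting W) (splitting W′) (similar t n (complement W) (complement W′))
    where
    module _ {Q : V (suc n ℕ.* 2 ℕ.+ index t) → Carrier} (W : HasWittIndex (suc n) Q) where
      open HasWittIndex W

      splitting : HyperbolicSplitting Q (first attained)
      splitting = split quadratic nondegenerate (first attained) (first≉0 attained)
        (TotallySingular.singular attained e₀)

      complement : HasWittIndex n (Q ∘ HyperbolicSplitting.ι splitting)
      complement = record
        { quadratic     = complement-quadratic quadratic splitting
        ; nondegenerate = complement-nondegenerate quadratic splitting nondegenerate
        ; attained      = complement-singular quadratic attained splitting
        ; maximal       = complement-maximal quadratic splitting maximal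
        }

-- Parametrised subspaces, generators of quadrics and equations of hyperplanes.

module Subspaces {c ℓ₁ ℓ₂ : Level} {q : ℕ} (F : FiniteField c ℓ₁ ℓ₂ q) where

  open LinearAlgebra F
  open QuadraticSpaces F
  open Geometry F
  open IsFunctional
  open IsQuadratic
  open Subspace

  private
    variable
      k l m n : ℕ

  form-quadratic : (f : QuadraticForm m) → IsQuadratic (f ⟦_⟧)
  form-quadratic f = quadratic-sum _ λ i → quadratic-sum _ λ j →
    quadratic-scale (f i j) (quadratic-* (coordinate i) (coordinate j))

  combination-linear : (b : Fin k → Vec m) → IsLinear λ a → combination a b
  combination-linear b j = sum-functional _ λ i → functional-* (b i j) (coordinate i)

  combination-closed : (S : Subspace m) (a : V k) {b : Fin k → Vec m} → (∀ i → b i ∈ S) → combination a b ∈ S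
  combination-closed {k = zero}  S a b∈S = 0-closed S
  combination-closed {k = suc _} S a b∈S =
    +-closed S (*-closed S (a zero) (b∈S zero)) (combination-closed S (tail a) (b∈S ∘ suc))

  functional-sum : {g : V n → Carrier} → IsFunctional g → (a : V k) (u : Fin k → V n) →
                   g (λ j → sum (λ i → a i * u i j)) ≈ sum (λ i → a i * g (u i))
  functional-sum {k = zero}  G a u = null G
  functional-sum {k = suc _} G a u = trans (G .add _ _)
    (+-cong (G .scale (a zero) (u zero)) (functional-sum G (tail a) (u ∘ suc)))

  unit : Fin n → V n
  unit zero    = e₀
  unit (suc i) = 0# ∷ unit i

  sum-units : (a : V n) (j : Fin n) → sum (λ i → a i * unit i j) ≈ a j
  sum-units a zero = begin
    a zero * 1# + sum (λ i → a (suc i) * 0#)   ≈⟨ +-cong (*-identityʳ _) (null′ (tail a)) ⟩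
    a zero + 0#                                ≈⟨ +-identityʳ _ ⟩
    a zero                                     ∎
    where
    null′ : (a : V n) → sum (λ i → a i * 0#) ≈ 0#
    null′ {zero}  a = refl
    null′ {suc _} a = trans (+-cong (zeroʳ _) (null′ (tail a))) (+-identityˡ 0#)
  sum-units a (suc j) = trans (+-cong (zeroʳ _) (sum-units (tail a) j)) (+-identityˡ _)

  -- A basis in the form of an injective linear map, which can be composed with other linear maps.
  record Parametrisation (S : Subspace m) (k : ℕ) : Set (c ⊔ ℓ₁) where
    field
      point     : V k → Vec m
      linear    : IsLinear point
      injective : Injective₀ point
      inside    : ∀ a → point a ∈ S
      covers    : ∀ {x} → x ∈ S → ∃[ a ] x ≋ point a

  parametrise : {S : Subspace m} → HasRank S k → Parametrisation S k
  parametrise {S = S} (b , isBasis) = record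
    { point     = λ a → combination a b
    ; linear    = combination-linear b
    ; injective = λ {a} → independent a
    ; inside    = λ a → combination-closed S a members
    ; covers    = spanning
    }
    where open IsBasis isBasis

  hasRank : {S : Subspace m} → Parametrisation S k → HasRank S k
  hasRank {m} {k} P = point ∘ unit , record
    { members     = inside ∘ unit
    ; independent = λ a eq → injective (≋-trans (≋-sym (point≋ a)) eq)
    ; spanning    = λ x∈S → let a , x≋ = covers x∈S in a , ≋-trans x≋ (≋-sym (point≋ a))
    }
    where
    open Parametrisation P
    point≋ : ∀ a → combination a (point ∘ unit) ≋ point a
    point≋ a j = trans (sym (functional-sum (linear j) a unit)) (linear j .cong (sum-units a))

  rank-mono : {S T : Subspace m} → Parametrisation S k → Parametrisation T l → S ⊆ T → k ≤ l
  rank-mono {l = l} P P′ S⊆T = rank-bound l {proj₁ ∘ lift}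
    (lift-linear P.linear P′.linear P′.injective (proj₂ ∘ lift))
    λ {a} eq → P.injective λ j → trans (sym (lift a .proj₂ j)) (trans (P′.linear j .cong eq) (null (P′.linear j)))
    where
    module P = Parametrisation P
    module P′ = Parametrisation P′
    lift : ∀ a → ∃[ a′ ] P′.point a′ ≋ P.point a
    lift a = let a′ , eq = P′.covers (S⊆T (P.inside a)) in a′ , ≋-sym eq

  image : {M : V k → Vec m} → IsLinear M → Subspace m
  image {M = M} L = record
    { member   = λ x → ∃[ a ] x ≋ M a
    ; respects = λ x≋y (a , x≋) → a , ≋-trans (≋-sym x≋y) x≋
    ; 0-closed = 0ⱽ , λ j → sym (null (L j))
    ; +-closed = λ (a , x≋) (b , y≋) → a ⊕ b , λ j → trans (+-cong (x≋ j) (y≋ j)) (sym (L j .add a b))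
    ; *-closed = λ s (a , x≋) → s ⊙ a , λ j → trans (*-congˡ (x≋ j)) (sym (L j .scale s a))
    }

  totallySingular : {f : QuadraticForm m} {S : Subspace m} → Parametrisation S k →
                    (∀ {x} → x ∈ S → f ⟦ x ⟧ ≈ 0#) → TotallySingular k (f ⟦_⟧)
  totallySingular P singular = record
    { embed     = point
    ; linear    = linear
    ; injective = injective
    ; singular  = singular ∘ inside
    }
    where open Parametrisation P

  module Quadric {t n m k} {f : QuadraticForm n} {U : Subspace n} (isQuadric : IsQuadric t f U m)
                 (exact : suc m ≡ k ℕ.* 2 ℕ.+ index t) where
    open IsQuadric isQuadric

    half : (suc m ∸ index t) / 2 ≡ k
    half = ≡.trans (≡.cong (λ s → (s ∸ index t) / 2) exact)
      (≡.trans (≡.cong (_/ 2) (ℕ.m+n∸n≡m (k ℕ.* 2) (index t))) (m*n/n≡m k 2))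

    generator-parametrisation : Parametrisation generator k
    generator-parametrisation = parametrise (≡.subst (HasRank generator) half generatorRank)

    open IsGenerator isGenerator using (contained) public

    -- `IsGenerator` and `generatorRank` each supply a rank of the same subspace; `rank-mono` turns
    -- the bound by the former into a bound by `k`.
    rank-≤ : ∀ {W l} → ContainedInQuadric f U W → Parametrisation W l → l ≤ k
    rank-≤ contained P = ℕ.≤-trans (IsGenerator.maximal isGenerator _ _ contained (hasRank P))
      (rank-mono (parametrise (IsGenerator.hasRank isGenerator)) generator-parametrisation id)

    singular-≤ : ∀ {l} (T : TotallySingular l (f ⟦_⟧)) → (∀ a → TotallySingular.embed T a ∈ U) → l ≤ k
    singular-≤ T inside = rank-≤ {W = image linear}
      ( (λ (a , x≋) → respects U (≋-sym x≋) (inside a))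
      , (λ (a , x≋) → trans (form-quadratic f .Q-cong x≋) (singular a)))
      (record
        { point     = embed
        ; linear    = linear
        ; injective = injective
        ; inside    = λ a → a , ≋-refl
        ; covers    = id
        })
      where open TotallySingular T

    attained : TotallySingular k (f ⟦_⟧)
    attained = totallySingular {f = f} generator-parametrisation (contained .proj₂)

    attained-inside : ∀ a → TotallySingular.embed attained a ∈ U
    attained-inside a = contained .proj₁ (Parametrisation.inside generator-parametrisation a)

  quadric-witt : ∀ {t m k} {f : QuadraticForm m} → IsQuadric t f whole m →
                 suc m ≡ k ℕ.* 2 ℕ.+ index t → HasWittIndex k (f ⟦_⟧)
  quadric-witt {k = k} {f = f} isQuadric exact = record
    { quadratic     = form-quadratic f
    ; nondegenerate = λ fx≈0 x⊥ → IsQuadric.nonDegenerate isQuadric _ fx≈0 λ {y} _ → x⊥ y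
    ; attained      = attained
    ; maximal       = λ T → ℕ.1+n≰n (singular-≤ T _)
    }
    where open Quadric {k = k} isQuadric exact

  record Hyperplane (H : Subspace m) : Set (c ⊔ ℓ₁) where
    field
      equation   : Vec m → Carrier
      functional : IsFunctional equation
      vanishes   : ∀ {x} → x ∈ H → equation x ≈ 0#
      defines    : ∀ {x} → equation x ≈ 0# → x ∈ H
      off        : Vec m
      off≉0      : equation off ≉0

  -- A vector `v` outside `H` completes a parametrisation of `H` to coordinates on the whole space.
  -- The equation of `H` is the coordinate along `v`.
  hyperplane : {H : Subspace m} → HasRank H m → Hyperplane H
  hyperplane {m} {H} rank = from-outside outside
    where
    open Parametrisation (parametrise rank)
    in-H : ∀ {x} → ∃[ a ] point a ≋ x → x ∈ H
    in-H (a , eq) = respects H eq (inside a)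

    outside : ∃[ v ] ¬ (∃[ a ] point a ≋ v)
    outside with search (suc m) (λ x≋y x∉ (a , eq) → x∉ (a , ≋-trans eq (≋-sym x≋y))) (λ x → ¬? (image? linear x))
    ... | yes found = found
    -- If every vector were in `H`, its coordinates there would inject rank `suc m` into rank `m`.
    ... | no none   = contradiction (rank-bound m
            (lift-linear coordinate linear injective (proj₂ ∘ covered))
            λ {x} eq j → trans (sym (covered x .proj₂ j)) (trans (linear j .cong eq) (null (linear j)))) ℕ.1+n≰n
      where
      covered : ∀ x → ∃[ a ] point a ≋ x
      covered x = decidable-stable (image? linear x) λ x∉ → none (x , x∉)

    from-outside : ∃[ v ] ¬ (∃[ a ] point a ≋ v) → Hyperplane H
    from-outside (v , v∉) = record
      { equation   = head ∘ N
      ; functional = N-linear zero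
      ; vanishes   = λ {x} x∈H → let a , x≋ = covers x∈H in trans
          (N-linear zero .cong (λ j → trans (x≋ j) (sym (trans (+-congʳ (zeroˡ _)) (+-identityˡ _)))))
          (N∘M (0# ∷ a) zero)
      ; defines    = λ {x} eq → in-H (tail (N x) , λ j → begin
          point (tail (N x)) j                        ≈⟨ +-identityˡ _ ⟨
          0# + point (tail (N x)) j                   ≈⟨ +-congʳ (trans (*-congʳ eq) (zeroˡ _)) ⟨
          head (N x) * v j + point (tail (N x)) j     ≈⟨ M∘N x j ⟩
          x j                                         ∎)
      ; off        = v
      ; off≉0      = λ eq → v∉ (tail (N v) , λ j → begin
          point (tail (N v)) j                        ≈⟨ +-identityˡ _ ⟨
          0# + point (tail (N v)) j                   ≈⟨ +-congʳ (trans (*-congʳ eq) (zeroˡ _)) ⟨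
          head (N v) * v j + point (tail (N v)) j     ≈⟨ M∘N v j ⟩
          v j                                         ∎)
      }
      where open LinearInverse (linear-inverse (extend-linear linear v) (λ {z} → extend-injective linear injective v v∉ {z}))

-- `k` is the linear rank of a generator. This form of the parity condition replaces the truncated
-- subtraction and the division by 2.
admissible-exact : ∀ t m → Admissible t m → ∃[ k ] suc m ≡ k ℕ.* 2 ℕ.+ index t
admissible-exact hyperbolic 0 ()
admissible-exact hyperbolic 1 _ = 1 , ≡.refl
admissible-exact parabolic  0 _ = 0 , ≡.refl
admissible-exact parabolic  1 ()
admissible-exact elliptic   0 ()
admissible-exact elliptic   1 _ = 0 , ≡.refl
admissible-exact hyperbolic (suc (suc m)) a = let k , eq = admissible-exact hyperbolic m a in suc k , ≡.cong (2 ℕ.+_) eq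
admissible-exact parabolic  (suc (suc m)) a = let k , eq = admissible-exact parabolic  m a in suc k , ≡.cong (2 ℕ.+_) eq
admissible-exact elliptic   (suc (suc m)) a = let k , eq = admissible-exact elliptic   m a in suc k , ≡.cong (2 ℕ.+_) eq

-- The extended form, its Witt index, and lifts of subspaces.

module Construction {c ℓ₁ ℓ₂ : Level} {q : ℕ} (F : FiniteField c ℓ₁ ℓ₂ q) where

  open LinearAlgebra F
  open QuadraticSpaces F
  open Subspaces F
  open Geometry F
  open IsFunctional
  open IsQuadratic
  open Subspace

  private
    variable
      k l m n : ℕ

  module Extension (form : QuadraticForm m) {b : Vec m → Carrier} (b-functional : IsFunctional b) where

    extended : Vec (suc m) → Carrier
    extended z = head z * b (tail z) + form ⟦ tail z ⟧

    extended-quadratic : IsQuadratic extended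
    extended-quadratic = quadratic-+
      (quadratic-* (coordinate zero) (functional-∘ b-functional tail-linear))
      (quadratic-∘ (form-quadratic form) tail-linear)

    extended-polar : ∀ z w → polarization extended z w ≈
                     head z * b (tail w) + head w * b (tail z) + polar form (tail z) (tail w)
    extended-polar z w = trans (+-congʳ (+-congʳ (+-congʳ (*-congˡ (b-functional .add (tail z) (tail w))))))
      (solve 7 (λ a a′ u u′ s p p′ → (a :+ a′) :* (u :+ u′) :+ s :- (a :* u :+ p) :- (a′ :* u′ :+ p′)
         := a :* u′ :+ a′ :* u :+ (s :- p :- p′)) refl
         (head z) (head w) (b (tail z)) (b (tail w)) (form ⟦ tail z ⊕ tail w ⟧) (form ⟦ tail z ⟧) (form ⟦ tail w ⟧))

    extended-kernel : ∀ {z} → b (tail z) ≈ 0# → extended z ≈ form ⟦ tail z ⟧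
    extended-kernel bz≈0 = trans (+-congʳ (trans (*-congˡ bz≈0) (zeroʳ _))) (+-identityˡ _)

    -- A vector with zero tail is a multiple of the vertex (1 , 0), so the vectors orthogonal to the
    -- vertex are those whose tail satisfies the equation of H.
    polar-vertex : ∀ {z w} → tail z ≋ 0ⱽ → polarization extended z w ≈ head z * b (tail w)
    polar-vertex {z} {w} z≋0 = begin
      polarization extended z w
        ≈⟨ extended-polar z w ⟩
      head z * b (tail w) + head w * b (tail z) + polar form (tail z) (tail w)
        ≈⟨ +-cong (+-congˡ (trans (*-congˡ (trans (b-functional .cong z≋0) (null b-functional))) (zeroʳ _)))
             (polar-null (form-quadratic form) (tail z) (tail w) z≋0) ⟩
      head z * b (tail w) + 0# + 0#
        ≈⟨ trans (+-identityʳ _) (+-identityʳ _) ⟩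
      head z * b (tail w) ∎

  module ExtendedQuadric {t m k} {form : QuadraticForm (suc m)} {H : Subspace (suc m)} (isQuadric : IsQuadric t form H m)
           (exact : suc m ≡ k ℕ.* 2 ℕ.+ index t) (plane : Hyperplane H) where

    private
      module Q = Quadric {k = k} isQuadric exact

    open Hyperplane plane public renaming (equation to b; functional to b-functional)
    open Extension form b-functional public

    -- Let `z` be singular and in the radical. Its product with the vertex puts the tail in `H`,
    -- products with vectors over `H` put it in the radical of the quadric there, so the tail is
    -- zero; a vector over `off` then annihilates the head.
    extended-nondegenerate : Nondegenerate extended
    extended-nondegenerate {z} Qz≈0 z⊥ = λ where
        zero    → vertex≈0
        (suc i) → tail≋0 i
      where
      tail∈H : b (tail z) ≈ 0#
      tail∈H = begin
        b (tail z)                        ≈⟨ *-identityˡ _ ⟨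
        1# * b (tail z)                   ≈⟨ polar-vertex {e₀} {z} ≋-refl ⟨
        polarization extended e₀ z        ≈⟨ polar-sym extended-quadratic e₀ z ⟩
        polarization extended z e₀        ≈⟨ z⊥ e₀ ⟩
        0#                                ∎

      tail≋0 : tail z ≋ 0ⱽ
      tail≋0 = IsQuadric.nonDegenerate isQuadric {tail z} (defines tail∈H)
        (trans (sym (extended-kernel {z} tail∈H)) Qz≈0) λ {y} y∈H → begin
          polar form (tail z) y
            ≈⟨ trans (+-congʳ (trans (+-cong (trans (*-congˡ (vanishes y∈H)) (zeroʳ _)) (zeroˡ _)) (+-identityˡ 0#))) (+-identityˡ _) ⟨
          head z * b y + 0# * b (tail z) + polar form (tail z) y
            ≈⟨ extended-polar z (0# ∷ y) ⟨
          polarization extended z (0# ∷ y)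
            ≈⟨ z⊥ (0# ∷ y) ⟩
          0# ∎

      vertex≈0 : head z ≈ 0#
      vertex≈0 = integral off≉0 (begin
        b off * head z                        ≈⟨ *-comm _ _ ⟩
        head z * b off                        ≈⟨ polar-vertex {z} {0# ∷ off} tail≋0 ⟨
        polarization extended z (0# ∷ off)    ≈⟨ z⊥ (0# ∷ off) ⟩
        0#                                    ∎)

    extended-attained : TotallySingular (suc k) extended
    extended-attained = record
      { embed     = λ x → head x ∷ T.embed (tail x)
      ; linear    = ∷-linear (coordinate zero) (linear-∘ T.linear tail-linear)
      ; injective = λ {x} eq → λ where
          zero    → eq zero
          (suc i) → T.injective {tail x} (eq ∘ suc) i
      ; singular  = λ x → trans (extended-kernel {head x ∷ T.embed (tail x)} (vanishes (Q.attained-inside (tail x)))) (T.singular (tail x))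
      }
      where module T = TotallySingular Q.attained

    -- Projection from the vertex turns totally singular vectors orthogonal to the vertex into
    -- totally singular vectors of `H`, where the rank is at most `k`. If all of `T` is orthogonal
    -- to the vertex, the projection loses at most one dimension. If not, a hyperplane of `T` is,
    -- and it does not contain the vertex, since some vector of `T` is not orthogonal to it. Either
    -- way rank at least `suc k` survives.
    extended-maximal : ¬ TotallySingular (suc (suc k)) extended
    extended-maximal T = [ in-vertex-perp , beyond-vertex-perp ]′ (zero-or-not b-linear)
      where
      open TotallySingular T

      base : V (suc (suc k)) → Vec (suc m)
      base = tail ∘ embed

      base-linear : IsLinear base
      base-linear = linear-∘ tail-linear linear

      b-linear : IsFunctional (b ∘ base)
      b-linear = functional-∘ b-functional base-linear

      too-large : ∀ {l} {ι : V l → V (suc (suc k))} → k ℕ.< l → IsLinear ι → Injective₀ (base ∘ ι) →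
                  ¬ (∀ y → b (base (ι y)) ≈ 0#)
      too-large {ι = ι} k<l ι-linear inj bι≈0 = ℕ.<⇒≱ k<l (Q.singular-≤ (record
        { embed     = base ∘ ι
        ; linear    = linear-∘ base-linear ι-linear
        ; injective = inj
        ; singular  = λ y → trans (sym (extended-kernel {embed (ι y)} (bι≈0 y))) (singular (ι y))
        }) (defines ∘ bι≈0))

      from-head-tail : ∀ {x} → head (embed x) ≈ 0# → base x ≋ 0ⱽ → x ≋ 0ⱽ
      from-head-tail h≈0 t≋0 = injective λ where
        zero    → h≈0
        (suc i) → t≋0 i

      in-vertex-perp : ¬ (∀ x → b (base x) ≈ 0#)
      in-vertex-perp b≈0 = [ (λ h≈0 → too-large {ι = id} (ℕ.m≤n⇒m≤1+n ℕ.≤-refl) coordinate (λ {x} → from-head-tail {x} (h≈0 x)) b≈0)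
                           , (λ (x , hx≉0) → restrict (kernel (suc k) (linear zero) x hx≉0))
                           ]′ (zero-or-not (linear zero))
        where
        restrict : ¬ KernelCoordinates (head ∘ embed)
        restrict K = too-large {ι = ι} ℕ.≤-refl ι-linear (λ {y} eq → ι-injective (from-head-tail {ι y} (g∘ι y) eq)) (b≈0 ∘ ι)
          where open KernelCoordinates K

      beyond-vertex-perp : ¬ (∃[ x ] b (base x) ≉0)
      beyond-vertex-perp (x , bx≉0) = restrict (kernel (suc k) b-linear x bx≉0)
        where
        restrict : ¬ KernelCoordinates (b ∘ base)
        restrict K = too-large {ι = ι} ℕ.≤-refl ι-linear (λ {y} eq → ι-injective (from-head-tail {ι y} (integral bx≉0 (begin
          b (base x) * head (embed (ι y))                ≈⟨ *-comm _ _ ⟩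
          head (embed (ι y)) * b (base x)                ≈⟨ polar-vertex {embed (ι y)} {embed x} eq ⟨
          polarization extended (embed (ι y)) (embed x)
            ≈⟨ polar-zero extended-quadratic (embed (ι y)) (embed x) (singular (ι y)) (singular x) (trans
                 (extended-quadratic .Q-cong λ i → sym (linear i .add (ι y) x)) (singular (ι y ⊕ x))) ⟩
          0#                                             ∎)) eq)) g∘ι
          where open KernelCoordinates K

    extended-witt : HasWittIndex (suc k) extended
    extended-witt = record
      { quadratic     = extended-quadratic
      ; nondegenerate = extended-nondegenerate
      ; attained      = extended-attained
      ; maximal       = extended-maximal
      }

  similar-dim : ∀ t n {N} → N ≡ n ℕ.* 2 ℕ.+ index t → {Q Q′ : V N → Carrier} →
                HasWittIndex n Q → HasWittIndex n Q′ → Similar Q Q′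
  similar-dim t n ≡.refl = similar t n

  -- The join of the vertex and `S`.
  cone : Subspace m → Subspace (suc m)
  cone S = record
    { member   = λ z → tail z ∈ S
    ; respects = λ z≋w → respects S (z≋w ∘ suc)
    ; 0-closed = 0-closed S
    ; +-closed = λ z∈S w∈S → +-closed S z∈S w∈S
    ; *-closed = λ a z∈S → *-closed S a z∈S
    }

  cone-parametrisation : {S : Subspace m} → Parametrisation S k → Parametrisation (cone S) (suc k)
  cone-parametrisation P = record
    { point     = λ a → head a ∷ point (tail a)
    ; linear    = ∷-linear (coordinate zero) (linear-∘ linear tail-linear)
    ; injective = λ {a} eq → λ where
        zero    → eq zero
        (suc i) → injective {tail a} (eq ∘ suc) i
    ; inside    = inside ∘ tail
    ; covers    = λ {z} z∈S → let a , z≋ = covers z∈S in head z ∷ a , λ where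
        zero    → refl
        (suc i) → z≋ i
    }
    where open Parametrisation P

  module _ {α : Vec m → Carrier} (α-functional : IsFunctional α) where

    graph : Subspace m → Subspace (suc m)
    graph S = record
      { member   = λ z → tail z ∈ S × head z ≈ α (tail z)
      ; respects = λ z≋w (z∈S , eq) → respects S (z≋w ∘ suc) z∈S ,
          trans (sym (z≋w zero)) (trans eq (α-functional .cong (z≋w ∘ suc)))
      ; 0-closed = 0-closed S , sym (null α-functional)
      ; +-closed = λ (z∈S , eq) (w∈S , eq′) → +-closed S z∈S w∈S ,
          trans (+-cong eq eq′) (sym (α-functional .add _ _))
      ; *-closed = λ a (z∈S , eq) → *-closed S a z∈S , trans (*-congˡ eq) (sym (α-functional .scale a _))
      }

    graph-parametrisation : {S : Subspace m} → Parametrisation S k → Parametrisation (graph S) k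
    graph-parametrisation P = record
      { point     = λ a → α (point a) ∷ point a
      ; linear    = ∷-linear (functional-∘ α-functional linear) linear
      ; injective = λ eq → injective (eq ∘ suc)
      ; inside    = λ a → inside a , refl
      ; covers    = λ (z∈S , eq) → let a , z≋ = covers z∈S in a , λ where
          zero    → trans eq (α-functional .cong z≋)
          (suc i) → z≋ i
      }
      where open Parametrisation P

  module _ {M : Vec m → Vec m} (L : IsLinear M) where

    preimage : Subspace m → Subspace m
    preimage S = record
      { member   = λ x → M x ∈ S
      ; respects = λ x≋y → respects S λ i → L i .cong x≋y
      ; 0-closed = respects S (λ i → sym (null (L i))) (0-closed S)
      ; +-closed = λ x∈S y∈S → respects S (λ i → sym (L i .add _ _)) (+-closed S x∈S y∈S)
      ; *-closed = λ a x∈S → respects S (λ i → sym (L i .scale a _)) (*-closed S a x∈S)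
      }

    preimage-parametrisation : LinearInverse M → {S : Subspace m} → Parametrisation S k → Parametrisation (preimage S) k
    preimage-parametrisation I {S} P = record
      { point     = N ∘ point
      ; linear    = linear-∘ N-linear linear
      ; injective = λ {a} eq → injective (≋-trans (≋-sym (M∘N (point a))) λ i → trans (L i .cong eq) (null (L i)))
      ; inside    = λ a → respects S (≋-sym (M∘N (point a))) (inside a)
      ; covers    = λ {x} x∈S → let a , Mx≋ = covers x∈S in
          a , ≋-trans (≋-sym (N∘M x)) λ i → N-linear i .cong Mx≋
      }
      where
      open Parametrisation P
      open LinearInverse I

  -- A vector mapped to zero is singular and orthogonal to every vector.
  similar-injective : {Q : V m → Carrier} {Q′ : V n → Carrier} → Nondegenerate Q → IsQuadratic Q′ →
                      (sim : Similar Q Q′) → Injective₀ (Similar.map sim)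
  similar-injective {Q = Q} {Q′} nonDeg isQ′ sim {x} eq = nonDeg Qx≈0 λ y → begin
      Q (x ⊕ y) - Q x - Q y
        ≈⟨ +-cong (+-cong (similitude _) (-‿cong (similitude x))) (-‿cong (similitude y)) ⟩
      factor * Q′ (map (x ⊕ y)) - factor * Q′ (map x) - factor * Q′ (map y)
        ≈⟨ solve 4 (λ f s a b → f :* s :- f :* a :- f :* b := f :* (s :- a :- b)) refl factor _ _ _ ⟩
      factor * (Q′ (map (x ⊕ y)) - Q′ (map x) - Q′ (map y))
        ≈⟨ *-congˡ (sym (polarization-∘ isQ′ linear x y)) ⟩
      factor * polarization Q′ (map x) (map y)
        ≈⟨ trans (*-congˡ (polar-null isQ′ (map x) (map y) eq)) (zeroʳ _) ⟩
      0# ∎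
    where
    open Similar sim
    Qx≈0 : Q x ≈ 0#
    Qx≈0 = trans (similitude x) (trans (*-congˡ (trans (isQ′ .Q-cong eq) (Q-null isQ′))) (zeroʳ _))

  -- From the affine partition to the spread.

  module FromPartition {t r} (A : QuadricAVSP t r) {k} (exact : suc r ≡ k ℕ.* 2 ℕ.+ index t)
                       (plane : Hyperplane (QuadricAVSP.H A)) where
    open QuadricAVSP A
    open IsAVSP isAVSP using (notInH; partition)
    open ExtendedQuadric {k = k} isQuadric exact plane

    private
      module P i = Parametrisation (parametrise (dimensions i))
      module Q = Quadric {k = k} isQuadric exact

    B : Vec (suc r) → Vec (suc r) → Carrier
    B = polar form

    isForm : IsQuadratic (form ⟦_⟧)
    isForm = form-quadratic form

    apex : ∀ i → ∃[ s ] s ∈ S i × b s ≈ 1#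
    apex i = [ (λ b≈0 → ⊥-elim (notInH i (inside-H b≈0))) , normalise ]′
        (zero-or-not (functional-∘ b-functional (P.linear i)))
      where
      inside-H : (∀ a → b (P.point i a) ≈ 0#) → S i ⊆ H
      inside-H b≈0 x∈S = let a , x≋ = P.covers i x∈S in defines (trans (b-functional .cong x≋) (b≈0 a))
      normalise : ∃[ a ] b (P.point i a) ≉0 → ∃[ s ] s ∈ S i × b s ≈ 1#
      normalise (a , ba≉0) = let d , bad≈1 = inverse ba≉0 in
        d ⊙ P.point i a , *-closed (S i) d (P.inside i a) ,
        trans (b-functional .scale d _) (trans (*-comm d _) bad≈1)

    s : ∀ i → Vec (suc r)
    s i = apex i .proj₁

    s∈S : ∀ i → s i ∈ S i
    s∈S i = apex i .proj₂ .proj₁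

    bs≈1 : ∀ i → b (s i) ≈ 1#
    bs≈1 i = apex i .proj₂ .proj₂

    -- For x ∈ S i with b x ≉ 0#, this is the only scalar a with extended (a ∷ x) ≈ 0#,
    -- because form vanishes at x - b x s ∈ Π i.
    α : ∀ i → Vec (suc r) → Carrier
    α i x = b x * form ⟦ s i ⟧ + - 1# * B x (s i)

    α-functional : ∀ i → IsFunctional (α i)
    α-functional i = +-functional (functional-* _ b-functional) (*-functional (- 1#) (polar-functionalˡ isForm (s i)))

    to-H : ∀ i {u} → u ∈ S i → u ⊕ (- b u) ⊙ s i ∈ Π i
    to-H i {u} u∈S = +-closed (S i) u∈S (*-closed (S i) (- b u) (s∈S i)) , defines (begin
      b (u ⊕ (- b u) ⊙ s i)    ≈⟨ trans (b-functional .add u _) (+-congˡ (b-functional .scale _ _)) ⟩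
      b u + - b u * b (s i)    ≈⟨ +-congˡ (trans (*-congˡ (bs≈1 i)) (*-identityʳ _)) ⟩
      b u - b u                ≈⟨ -‿inverseʳ _ ⟩
      0#                       ∎)

    Π-singular : ∀ i {x} → x ∈ Π i → form ⟦ x ⟧ ≈ 0#
    Π-singular i = IsGenerator.contained (Π-generators i) .proj₂

    -- The vector `u - b u s` lies in `Π i`, which is totally singular, so it is orthogonal to `x`.
    -- Thus on `S i` the functional `B x` is a multiple of `b`.
    Π-polar : ∀ i {x u} → x ∈ Π i → u ∈ S i → B x u ≈ b u * B x (s i)
    Π-polar i {x} {u} x∈Π u∈S = begin
      B x u
        ≈⟨ solve 2 (λ p e → p := p :+ (:- e) :+ e) refl (B x u) (b u * B x (s i)) ⟩
      B x u + - (b u * B x (s i)) + b u * B x (s i)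
        ≈⟨ +-congʳ (+-congˡ (trans (isForm .polar-functional x .scale (- b u) (s i)) (sym (-‿distribˡ-* _ _)))) ⟨
      B x u + B x ((- b u) ⊙ s i) + b u * B x (s i)
        ≈⟨ +-congʳ (isForm .polar-functional x .add u ((- b u) ⊙ s i)) ⟨
      B x (u ⊕ (- b u) ⊙ s i) + b u * B x (s i)
        ≈⟨ +-congʳ (polar-zero isForm x (u ⊕ (- b u) ⊙ s i) (Π-singular i x∈Π) (Π-singular i (to-H i u∈S))
             (Π-singular i (+-closed (Π i) x∈Π (to-H i u∈S)))) ⟩
      0# + b u * B x (s i)
        ≈⟨ +-identityˡ _ ⟩
      b u * B x (s i) ∎

    -- With the head equal to `α i x`, the extended form takes the value of `form` at `x - b x s`,
    -- and this vector lies in `Π i`.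
    graph-singular : ∀ i {z} → z ∈ graph (α-functional i) (S i) → extended z ≈ 0#
    graph-singular i {z} (x∈S , eq) = begin
      head z * b x + form ⟦ x ⟧
        ≈⟨ +-congʳ (*-congʳ (trans eq (+-congˡ (-1*x≈-x _)))) ⟩
      (b x * form ⟦ s i ⟧ - B x (s i)) * b x + form ⟦ x ⟧
        ≈⟨ solve 4 (λ β f p g → (β :* f :- p) :* β :+ g := g :+ (:- β) :* (:- β) :* f :+ (:- β) :* p) refl
             (b x) (form ⟦ s i ⟧) (B x (s i)) (form ⟦ x ⟧) ⟩
      form ⟦ x ⟧ + - b x * - b x * form ⟦ s i ⟧ + - b x * B x (s i)
        ≈⟨ +-cong (+-congˡ (isForm .Q-scale (- b x) (s i))) (isForm .polar-functional x .scale (- b x) (s i)) ⟨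
      form ⟦ x ⟧ + form ⟦ (- b x) ⊙ s i ⟧ + B x ((- b x) ⊙ s i)
        ≈⟨ Q-⊕ isForm x ((- b x) ⊙ s i) ⟨
      form ⟦ x ⊕ (- b x) ⊙ s i ⟧
        ≈⟨ Π-singular i (to-H i x∈S) ⟩
      0# ∎
      where x = tail z

    cone-singular : ∀ {z} → z ∈ cone Π₀ → extended z ≈ 0#
    cone-singular {z} z∈ = let ⊆H , singular = IsGenerator.contained Π₀-generator in
      trans (extended-kernel {z} (vanishes (⊆H z∈))) (singular z∈)

    vertex-vanishes : ∀ i {z} → z ∈ graph (α-functional i) (S i) → tail z ≋ 0ⱽ → z ≋ 0ⱽ
    vertex-vanishes i (_ , eq) x≋0 = λ where
      zero    → trans eq (trans (α-functional i .cong x≋0) (null (α-functional i)))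
      (suc j) → x≋0 j

    graph-cone-disjoint : ∀ i → Disjoint (graph (α-functional i) (S i)) (cone Π₀)
    graph-cone-disjoint i {z} z∈@(x∈S , _) x∈Π₀ = vertex-vanishes i {z} z∈
      (Π₀-disjoint i (x∈S , IsGenerator.contained Π₀-generator .proj₁ x∈Π₀) x∈Π₀)

    -- A common vector over x ∈ Π i ∩ Π j forces B x (s i) ≈ B x (s j), and then
    -- x lies in the radical of ⟨ S i , S j ⟩ ∩ H.
    common-radical : ∀ {i j x} → x ∈ Π i → x ∈ Π j → B x (s i) ≈ B x (s j) →
                     ∀ {y} → y ∈ ⟨ S i , S j ⟩ ∩ H → B x y ≈ 0#
    common-radical {i} {j} {x} x∈Πi x∈Πj eq {y} ((u , v , u∈S , v∈S , y≋) , y∈H) = begin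
      B x y
        ≈⟨ trans (isForm .polar-functional x .cong y≋) (isForm .polar-functional x .add u v) ⟩
      B x u + B x v
        ≈⟨ +-cong (Π-polar i x∈Πi u∈S) (Π-polar j x∈Πj v∈S) ⟩
      b u * B x (s i) + b v * B x (s j)
        ≈⟨ +-congʳ (*-congˡ eq) ⟩
      b u * B x (s j) + b v * B x (s j)
        ≈⟨ distribʳ _ _ _ ⟨
      (b u + b v) * B x (s j)
        ≈⟨ *-congʳ (trans (sym (b-functional .add u v)) (trans (b-functional .cong (≋-sym y≋)) (vanishes y∈H))) ⟩
      0# * B x (s j)
        ≈⟨ zeroˡ _ ⟩
      0# ∎

    equal-polars : ∀ {i j z} → z ∈ graph (α-functional i) (S i) → z ∈ graph (α-functional j) (S j) →
                   b (tail z) ≈ 0# → B (tail z) (s i) ≈ B (tail z) (s j)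
    equal-polars {i} {j} {z} (_ , eq) (_ , eq′) bx≈0 = begin
      B x (s i)         ≈⟨ -‿involutive _ ⟨
      - - B x (s i)     ≈⟨ -‿cong (trans (sym (on-H i)) (trans (trans (sym eq) eq′) (on-H j))) ⟩
      - - B x (s j)     ≈⟨ -‿involutive _ ⟩
      B x (s j)         ∎
      where
      x = tail z
      on-H : ∀ i → α i x ≈ - B x (s i)
      on-H i = trans (+-cong (trans (*-congʳ bx≈0) (zeroˡ _)) (-1*x≈-x _)) (+-identityˡ _)

    graphs-disjoint : ∀ {i j} → i ≢ j → Disjoint (graph (α-functional i) (S i)) (graph (α-functional j) (S j))
    graphs-disjoint {i} {j} i≢j {z} z∈i@(x∈Si , _) z∈j@(x∈Sj , _) = by-cases (b (tail z) ≟ 0#) (tail z ≋? 0ⱽ)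
      where
      x = tail z
      by-cases : Dec (b x ≈ 0#) → Dec (x ≋ 0ⱽ) → z ≋ 0ⱽ
      by-cases _           (yes x≋0) = vertex-vanishes i {z} z∈i x≋0
      -- Off `H` the tail lies in only one member of the partition.
      by-cases (no bx≉0)   (no _)    = let _ , _ , unique = partition x (bx≉0 ∘ vanishes) in
        contradiction (≡.trans (≡.sym (unique x∈Si)) (unique x∈Sj)) i≢j
      -- Inside `H` the nonzero `x` makes `Π i` and `Π j` meet in exactly one point, so the quadric
      -- on `⟨ S i , S j ⟩ ∩ H` is non-degenerate; but `x` is a singular vector in its radical.
      by-cases (yes bx≈0)  (no x≉0)  = contradiction
        (IsQuadric.nonDegenerate (hyperbolicity i≢j ((x , (x∈Πi , x∈Πj) , x≉0) , Π-meet i≢j)) {x}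
          ((x , 0ⱽ , x∈Si , 0-closed (S j) , λ i → sym (+-identityʳ _)) , defines bx≈0)
          (Π-singular i x∈Πi)
          (common-radical {i} {j} {x} x∈Πi x∈Πj (equal-polars {i} {j} {z} z∈i z∈j bx≈0)))
        x≉0
        where
        x∈Πi : x ∈ Π i
        x∈Πi = x∈Si , defines bx≈0
        x∈Πj : x ∈ Π j
        x∈Πj = x∈Sj , defines bx≈0

    Lifted : Fin (suc (q ℕ.^ ((r ℕ.+ index t ℕ.+ 1) / 2))) → Subspace (suc (suc r))
    Lifted zero    = cone Π₀
    Lifted (suc i) = graph (α-functional i) (S i)

    lifted-singular : ∀ i {z} → z ∈ Lifted i → extended z ≈ 0#
    lifted-singular zero    {z} = cone-singular {z}
    lifted-singular (suc i) {z} = graph-singular i {z}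

    -- A lower bound is enough, since no totally singular subspace for `f` has rank above `suc k`.
    -- For `Π₀` it comes from comparing its maximality with the generator of rank `k` given by
    -- `isQuadric`.
    lifted-rank : ∀ i → ∃[ l ] suc k ≤ l × Parametrisation (Lifted i) l
    lifted-rank zero    = suc rank ,
      ℕ.s≤s (maximal _ k Q.contained (hasRank Q.generator-parametrisation)) ,
      cone-parametrisation (parametrise hasRankΠ₀)
      where open IsGenerator Π₀-generator renaming (hasRank to hasRankΠ₀)
    -- `dimensions` is projective: `S i` has dimension `k`, hence rank `suc k`.
    lifted-rank (suc i) = _ , ℕ.s≤s (ℕ.≤-reflexive (≡.sym Q.half)) ,
      graph-parametrisation (α-functional i) (parametrise (dimensions i))

    lifted-disjoint : ∀ {i j} → i ≢ j → Disjoint (Lifted i) (Lifted j)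
    lifted-disjoint {zero}  {zero}  i≢j         = contradiction ≡.refl i≢j
    lifted-disjoint {zero}  {suc j} i≢j {z} z∈ z∈′ = graph-cone-disjoint j {z} z∈′ z∈
    lifted-disjoint {suc i} {zero}  i≢j {z}     = graph-cone-disjoint i {z}
    lifted-disjoint {suc i} {suc j} i≢j {z}     = graphs-disjoint (i≢j ∘ ≡.cong suc) {z}

    spread : (f : QuadraticForm (suc (suc r))) → IsQuadric t f whole (suc (suc r)) → Spread t f
    spread f isQuadricᶠ = record
      -- The similitude matches the zeros of `f` with those of `extended`, so the members are pulled
      -- back along it; `Fin.cast` reconciles `… + 1` with the `suc` that makes room for the cone.
      { members    = λ i → preimage linear (Lifted (Fin.cast size i))
      ; generators = λ i → let l , k<l , P = lifted-rank (Fin.cast size i) in record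
          { contained = _ , λ {x} x∈ → trans (similitude x)
              (trans (*-congˡ (lifted-singular (Fin.cast size i) {map x} x∈)) (zeroʳ factor))
          ; rank      = l
          ; hasRank   = hasRank (preimage-parametrisation linear (linear-inverse linear map-injective) P)
          ; maximal   = λ W l′ contained rank → ℕ.≤-trans (Qᶠ.rank-≤ {W = W} contained (parametrise rank)) k<l
          }
      ; disjoint   = λ i≢j {x} x∈ x∈′ → map-injective (lifted-disjoint (i≢j ∘ cast-injective) {map x} x∈ x∈′)
      }
      where
      exactᶠ : suc (suc (suc r)) ≡ suc k ℕ.* 2 ℕ.+ index t
      exactᶠ = ≡.cong (2 ℕ.+_) exact

      module Qᶠ = Quadric {k = suc k} isQuadricᶠ exactᶠ

      sim : Similar (f ⟦_⟧) extended
      sim = similar-dim t (suc k) exactᶠ (quadric-witt isQuadricᶠ exactᶠ) extended-witt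

      open Similar sim

      map-injective : Injective₀ map
      map-injective = similar-injective
        (HasWittIndex.nondegenerate (quadric-witt {k = suc k} {f = f} isQuadricᶠ exactᶠ)) extended-quadratic sim

      size : q ℕ.^ ((suc (suc r) ℕ.+ index t ∸ 1) / 2) ℕ.+ 1 ≡ suc (q ℕ.^ ((r ℕ.+ index t ℕ.+ 1) / 2))
      size = ≡.trans (ℕ.+-comm _ 1) (≡.cong (λ s → suc (q ℕ.^ (s / 2))) (ℕ.+-comm 1 (r ℕ.+ index t)))

      cast-injective : ∀ {i j} → Fin.cast size i ≡ Fin.cast size j → i ≡ j
      cast-injective {i} {j} eq = Fin.toℕ-injective (≡.trans (≡.sym (Fin.toℕ-cast size i))
        (≡.trans (≡.cong Fin.toℕ eq) (Fin.toℕ-cast size j)))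

mainTheorem1 : ∀ {c ℓ₁ ℓ₂} (q : ℕ) → IsPrimePower q → (F : FiniteField c ℓ₁ ℓ₂ q) →
    (t : QuadricType) (r : ℕ) → Admissible t r →
    Geometry.QuadricAVSP F t r →
    (f : Geometry.QuadraticForm F (suc (suc r))) →
    Geometry.IsQuadric F t f (Geometry.whole F) (suc (suc r)) →
    Geometry.Spread F t f
mainTheorem1 q _ F t r admissible A f isQuadricᶠ =
  let k , exact = admissible-exact t r admissible
  in Construction.FromPartition.spread F A {k} exact
       (Subspaces.hyperplane F (Geometry.IsAVSP.hyperplane (Geometry.QuadricAVSP.isAVSP A))) f isQuadricᶠ
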